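{- The problem \textsc{Ordered Bucket Integrity} can be solved in $O(nc^2)$ time and space, where $n$ is the number of vertices of the input graph and $c$ is the given capacity.
   Context: Graphs are finite, simple and undirected. A bucket arrangement of a graph $G$ is a partition of $V(G)$ into an ordered sequence of $k$ buckets $B_1,\dots,B_k$ (for some $k$). Its width is $\max_i |B_i|$. An edge $\{u,v\}$ with $u\in B_i$ and $v\in B_j$ is short if $|i-j|<2$, and long otherwise. Let $\sigma=\langle v_1,\dots,v_n\rangle$ be an ordering of the vertices of $G$. A bucket arrangement $B_1,\dots,B_k$ of $G$ is called ordered (with respect to $\sigma$) if $i<j$ implies $p\le q$ for every $v_i\in B_p$, $v_j\in B_q$. \textsc{Ordered Bucket Integrity}: given a graph $G$, an ordering $\sigma$ of its vertices and a capacity $c\in\mathbb{N}$, find a bucket arrangement of $G$ that is ordered with respect to $\sigma$, has width at most $c$, and has the minimum number of long edges among all such arrangements. -}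

module Defs where

open import Data.Bool.Base using (if_then_else_)
open import Data.Fin.Base as Fin using (Fin; zero; toℕ)
import Data.Fin.Properties as Fin
open import Data.Fin.Permutation using (Permutation′; _⟨$⟩ʳ_)
open import Data.List.Base as List
  using (List; []; _∷_; _++_; length; filter; allFin; cartesianProduct; concatMap)
open import Data.Nat.Base
  using (ℕ; zero; suc; _+_; _*_; _∸_; _^_; _≤_; _<_; ∣_-_∣)
open import Data.Nat.Properties using (≤-totalOrder; _≟_; _<?_)
open import Data.List.Extrema ≤-totalOrder using (max)
open import Data.Product.Base using (Σ-syntax; ∃-syntax; _×_; _,_)
open import Data.Sum.Base using (_⊎_)
open import Data.Vec.Base using (Vec; lookup; replicate; _[_]≔_)
open import Function.Definitions using (StrictlySurjective)
open import Level using (0ℓ)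
open import Relation.Binary.Core using (Rel)
open import Relation.Binary.Definitions using (Decidable; Symmetric; Irreflexive)
open import Relation.Binary.PropositionalEquality.Core using (_≡_)
open import Relation.Nullary.Decidable.Core using (Dec; does; _×-dec_)
open import Relation.Nullary.Negation.Core using (¬_)
open import Relation.Unary.Properties using (∁?)

------------------------------------------------------------------------
-- Graphs and bucket arrangements

record Graph (n : ℕ) : Set₁ where
  field
    Adj    : Rel (Fin n) 0ℓ
    adj?   : Decidable Adj
    sym    : Symmetric Adj
    irrefl : Irreflexive _≡_ Adj

-- Each undirected edge is listed once, as the pair (u , v) with u < v.
edges : ∀ {n} → Graph n → List (Fin n × Fin n)
edges {n} G =
  filter (λ (u , v) → (u Fin.<? v) ×-dec Graph.adj? G u v)
         (cartesianProduct (allFin n) (allFin n))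

-- An ordered partition of the vertices, given by the bucket containing each
-- vertex; the parts of a partition are nonempty.
record Arrangement (n : ℕ) : Set where
  field
    k        : ℕ
    bucket   : Fin n → Fin k
    nonempty : StrictlySurjective _≡_ bucket

module _ {n : ℕ} (B : Arrangement n) where
  open Arrangement B

  bucketSize : Fin k → ℕ
  bucketSize i = length (filter (λ v → bucket v Fin.≟ i) (allFin n))

  width : ℕ
  width = max 0 (List.map bucketSize (allFin k))

  Short : Fin n × Fin n → Set
  Short (u , v) = ∣ toℕ (bucket u) - toℕ (bucket v) ∣ < 2

  short? : ∀ e → Dec (Short e)
  short? (u , v) = ∣ toℕ (bucket u) - toℕ (bucket v) ∣ <? 2

  #long : Graph n → ℕ
  #long G = length (filter (∁? short?) (edges G))

  -- σ ⟨$⟩ʳ i is the vertex at position i of the ordering.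
  Ordered : Permutation′ n → Set
  Ordered σ = ∀ {i j} → i Fin.< j → bucket (σ ⟨$⟩ʳ i) Fin.≤ bucket (σ ⟨$⟩ʳ j)

------------------------------------------------------------------------
-- A unit-cost word RAM with structured control flow
--
-- A program uses a fixed number r of registers, a fixed number a of
-- random-access work arrays, and a read-only random-access input.

data Operand (r : ℕ) : Set where
  lit : ℕ → Operand r
  reg : Fin r → Operand r

data Op : Set where
  add sub mul : Op

data Program (r a : ℕ) : Set where
  skip  : Program r a
  set   : Fin r → Operand r → Program r a
  arith : Fin r → Op → Operand r → Operand r → Program r a
  input : Fin r → Operand r → Program r a
  load  : Fin r → Fin a → Operand r → Program r a
  store : Fin a → Operand r → Operand r → Program r a
  seq   : Program r a → Program r a → Program r a
  if<   : Operand r → Operand r → Program r a → Program r a → Program r a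
  while< : Operand r → Operand r → Program r a → Program r a

record State (r a : ℕ) : Set where
  constructor ⟨_,_⟩
  field
    registers : Vec ℕ r
    arrays    : Vec (ℕ → ℕ) a

⟦_⟧ᵒ : Op → ℕ → ℕ → ℕ
⟦ add ⟧ᵒ = _+_
⟦ sub ⟧ᵒ = _∸_
⟦ mul ⟧ᵒ = _*_

⟦_⟧ : ∀ {r} → Operand r → Vec ℕ r → ℕ
⟦ lit m ⟧ R = m
⟦ reg x ⟧ R = lookup R x

_[_↦_] : (ℕ → ℕ) → ℕ → ℕ → (ℕ → ℕ)
(A [ i ↦ v ]) j = if does (j ≟ i) then v else A j

-- Execution on input In, where words hold values up to W and each work array
-- has S cells. Exceeding either bound, or reading outside the input, leaves
-- the program stuck. In  s ⊢ p ⇓ s′ within t  the index t is the exact number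
-- of instructions and tests executed.
module Execution (W S : ℕ) (In : List ℕ) where

  infix 4 _⊢_⇓_within_

  data _⊢_⇓_within_ {r a : ℕ} :
       State r a → Program r a → State r a → ℕ → Set where

    skip : ∀ {s} → s ⊢ skip ⇓ s within 1

    set : ∀ {R M x o} → ⟦ o ⟧ R ≤ W →
          ⟨ R , M ⟩ ⊢ set x o ⇓ ⟨ R [ x ]≔ ⟦ o ⟧ R , M ⟩ within 1

    arith : ∀ {R M x ⊕ o o′} → let v = ⟦ ⊕ ⟧ᵒ (⟦ o ⟧ R) (⟦ o′ ⟧ R) in
            v ≤ W →
            ⟨ R , M ⟩ ⊢ arith x ⊕ o o′ ⇓ ⟨ R [ x ]≔ v , M ⟩ within 1

    input : ∀ {R M x o} (i : Fin (length In)) → ⟦ o ⟧ R ≡ toℕ i →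
            List.lookup In i ≤ W →
            ⟨ R , M ⟩ ⊢ input x o ⇓ ⟨ R [ x ]≔ List.lookup In i , M ⟩ within 1

    load : ∀ {R M x A o} → ⟦ o ⟧ R < S →
           ⟨ R , M ⟩ ⊢ load x A o
             ⇓ ⟨ R [ x ]≔ lookup M A (⟦ o ⟧ R) , M ⟩ within 1

    store : ∀ {R M A o o′} → ⟦ o ⟧ R < S → ⟦ o′ ⟧ R ≤ W →
            ⟨ R , M ⟩ ⊢ store A o o′
              ⇓ ⟨ R , M [ A ]≔ (lookup M A [ ⟦ o ⟧ R ↦ ⟦ o′ ⟧ R ]) ⟩ within 1

    seq : ∀ {s s′ s″ p q t u} →
          s ⊢ p ⇓ s′ within t → s′ ⊢ q ⇓ s″ within u →
          s ⊢ seq p q ⇓ s″ within (t + u)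

    if-true : ∀ {R M s′ o o′ p q t} → ⟦ o ⟧ R < ⟦ o′ ⟧ R →
              ⟨ R , M ⟩ ⊢ p ⇓ s′ within t →
              ⟨ R , M ⟩ ⊢ if< o o′ p q ⇓ s′ within suc t

    if-false : ∀ {R M s′ o o′ p q t} → ⟦ o′ ⟧ R ≤ ⟦ o ⟧ R →
               ⟨ R , M ⟩ ⊢ q ⇓ s′ within t →
               ⟨ R , M ⟩ ⊢ if< o o′ p q ⇓ s′ within suc t

    while-true : ∀ {R M s′ s″ o o′ p t u} → ⟦ o ⟧ R < ⟦ o′ ⟧ R →
                 ⟨ R , M ⟩ ⊢ p ⇓ s′ within t →
                 s′ ⊢ while< o o′ p ⇓ s″ within u →
                 ⟨ R , M ⟩ ⊢ while< o o′ p ⇓ s″ within suc (t + u)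

    while-false : ∀ {R M o o′ p} → ⟦ o′ ⟧ R ≤ ⟦ o ⟧ R →
                  ⟨ R , M ⟩ ⊢ while< o o′ p ⇓ ⟨ R , M ⟩ within 1

open Execution using (_⊢_⇓_within_)

initial : ∀ {r a} → State r a
initial = ⟨ replicate _ 0 , replicate _ (λ _ → 0) ⟩

-- The first work array holds the output.
output : ∀ {r a} → State r (suc a) → ℕ → ℕ
output s = lookup (State.arrays s) zero

------------------------------------------------------------------------
-- Solvability within O(f) time and space

record Problem : Set₂ where
  field
    Instance : Set₁
    encode   : Instance → List ℕ
    Answers  : Instance → (ℕ → ℕ) → Set

-- Words of O(log (N + x)) bits, for an input of N words with largest entry x.
wordBound : ℕ → List ℕ → ℕ
wordBound K In = (2 + length In + max 0 In) ^ K

-- One program serves all instances. The space counts all registers and the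
-- cells of all work arrays; the read-only input is not counted. The additive
-- constant matters only for instances with f I = 0, where no program could
-- run in time K * f I.
SolvableInTimeAndSpaceO : (P : Problem) → (Problem.Instance P → ℕ) → Set₁
SolvableInTimeAndSpaceO P f =
  Σ[ r ∈ ℕ ] Σ[ a ∈ ℕ ] Σ[ p ∈ Program r (suc a) ] Σ[ K ∈ ℕ ]
  ∀ (I : Instance) →
    Σ[ S ∈ ℕ ] Σ[ s ∈ State r (suc a) ] Σ[ t ∈ ℕ ]
      (_⊢_⇓_within_ (wordBound K (encode I)) S (encode I) initial p s t
      × Answers I (output s)
      × t ≤ K * f I + K
      × r + suc a * S ≤ K * f I + K)
  where open Problem P

------------------------------------------------------------------------
-- Ordered Bucket Integrity

record OBI-Instance : Set₁ where
  field
    n : ℕ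
    G : Graph n
    σ : Permutation′ n
    c : ℕ

module _ (I : OBI-Instance) where
  open OBI-Instance I

  Feasible : Arrangement n → Set
  Feasible B = Ordered B σ × width B ≤ c

  Optimal : Arrangement n → Set
  Optimal B = Feasible B × (∀ B′ → Feasible B′ → #long B G ≤ #long B′ G)

  -- n, c, the ordering, and the adjacency matrix in row-major order. The graph
  -- must be queried in constant time per pair of vertices: with c fixed,
  -- merely reading all edges of a dense graph would exceed O(n c²).
  encodeOBI : List ℕ
  encodeOBI =
    n ∷ c ∷ List.map (λ i → toℕ (σ ⟨$⟩ʳ i)) (allFin n)
    ++ concatMap (λ u → List.map (λ v → bit u v) (allFin n)) (allFin n)
    where
    bit : Fin n → Fin n → ℕ
    bit u v = if does (Graph.adj? G u v) then 1 else 0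

  Represents : (ℕ → ℕ) → Arrangement n → Set
  Represents out B = out 1 ≡ k × (∀ v → out (2 + toℕ v) ≡ toℕ (bucket v))
    where open Arrangement B

  -- The first cell tells whether a feasible arrangement exists; there is none
  -- only for c = 0 < n.
  AnswersOBI : (ℕ → ℕ) → Set
  AnswersOBI out =
      (out 0 ≡ 0 × ¬ (∃[ B ] Feasible B))
    ⊎ (out 0 ≡ 1 × (∃[ B ] (Optimal B × Represents out B)))

OrderedBucketIntegrity : Problem
OrderedBucketIntegrity = record
  { Instance = OBI-Instance
  ; encode   = encodeOBI
  ; Answers  = AnswersOBI
  }

-- Place the vertices from left to right and record only the sizes a and d of
-- the current and of the previous bucket. For an arrangement ordered by σ, the
-- short edges joining the next vertex to earlier ones are exactly those to its
-- most recent a + d predecessors if it joins the current bucket, and to its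
-- most recent a predecessors if it opens a new one. So the largest number of
-- short edges is given by a recurrence over (position, a, d) with O(n c²)
-- states and two choices each; the number of edges from a position to its e
-- immediate predecessors, e ≤ 2c, is tabulated beforehand. Minimising long
-- edges is maximising short ones, and an optimal arrangement is read off by
-- following the better choice from the first position on.
module Submission where

open import Defs
open Execution hiding (_⊢_⇓_within_)
import Algebra.Properties.CommutativeMonoid.Sum
open import Data.Bool.Base using (Bool; true; false; if_then_else_; _∧_; T)
open import Data.Empty using (⊥)
open import Data.Fin.Base as Fin using (Fin; zero; suc; toℕ; fromℕ<)
open import Data.Fin.Patterns
open import Data.Fin.Permutation using (Permutation′; _⟨$⟩ʳ_; _⟨$⟩ˡ_; inverseˡ; inverseʳ)
import Data.Fin.Properties as Fin
open import Data.List.Base as List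
  using (List; []; _∷_; _++_; length; filter; allFin; tabulate; cartesianProduct; concatMap)
open import Data.List.Membership.Propositional.Properties using (∈-map⁺; ∈-allFin; ∈-lookup)
open import Data.List.Properties using (length-map; length-tabulate; length-++; map-tabulate)
import Data.List.Relation.Unary.All as All
import Data.List.Relation.Unary.All.Properties as All
open import Data.Nat.Base
open import Data.Nat.DivMod
open import Data.Nat.Divisibility using (divides-refl)
open import Data.Nat.Properties
open import Data.List.Extrema ≤-totalOrder using (max; f[argmax]≤v⁺; f[xs]≤f[argmax])
open import Data.Product.Base using (Σ-syntax; ∃-syntax; _×_; _,_; proj₁; proj₂)
open import Data.Sum.Base using (_⊎_; inj₁; inj₂)
open import Data.Unit.Base using (tt)
open import Data.Vec.Base using ([]; _∷_; lookup; _[_]≔_)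
open import Function.Base using (_∘_; id)
open import Level using (0ℓ)
open import Relation.Binary.Definitions using (tri<; tri≈; tri>)
open import Relation.Binary.PropositionalEquality hiding ([_])
open import Relation.Nullary.Decidable using (dec-true; dec-false)
open import Relation.Nullary.Decidable.Core using (Dec; does; yes; no; _×-dec_)
open import Relation.Nullary.Negation.Core using (¬_; contradiction)
open import Relation.Unary using (Pred; Decidable)
open import Relation.Unary.Properties using (∁?)

-- Widths, edges and the minimum are defined for maps from vertices to buckets, while the recurrence
-- runs over paths of (current size, previous size, index). Nonemptiness of buckets matches the two:
-- an ordered arrangement never skips an index, so every competitor is a path, and the path that the
-- algorithm follows is an arrangement. Optimality is then a telescoping argument along paths. The
-- obstacle in the counting is that `edges` orients an edge by vertex names, whereas the recurrence
-- charges it to its endpoint that is later in the ordering. The two counts agree because each is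
-- half of the same sum over all ordered pairs. On the machine, too large a word, an address out of
-- range and divergence all appear as the absence of a derivation, so every run is shown to exist
-- together with its time bound. Words are long enough because the main table has (n + 1)(c + 1)^2
-- cells, a product of three factors that the input bounds.

-- Total correctness and running time of RAM programs

record At (In : List ℕ) (p v : ℕ) : Set where
  constructor found
  field
    index    : Fin (length In)
    address  : p ≡ toℕ index
    content  : List.lookup In index ≡ v

-- The 0 for a loop is a placeholder: the `wp` of a loop is empty, so `run-wp` certifies this cost
-- only for runs that meet no loop.
cost : ∀ {r a} → Program r a → ℕ
cost (seq p q)     = cost p + cost q
cost (if< _ _ p q) = suc (cost p ⊔ cost q)
cost (while< _ _ _) = 0
cost _             = 1

module Logic (W S : ℕ) (In : List ℕ) where

  open Execution W S In using (_⊢_⇓_within_)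

  -- The exact step count is hidden behind an upper bound, so that branches of different lengths can
  -- share one `T`.
  record Run {r a} (p : Program r a) (s : State r a) (T : ℕ) (Q : State r a → Set) : Set where
    constructor ran
    field
      {final} : State r a
      {steps} : ℕ
      runs    : s ⊢ p ⇓ final within steps
      in-time : steps ≤ T
      post    : Q final

  run-weaken : ∀ {r a} {p : Program r a} {s T U Q P} → T ≤ U →
               (∀ {s′} → Q s′ → P s′) → Run p s T Q → Run p s U P
  run-weaken T≤U Q⇒P (ran e t≤T q) = ran e (≤-trans t≤T T≤U) (Q⇒P q)

  run-seq : ∀ {r a} {p q : Program r a} {s T U Q} →
            Run p s T (λ s′ → Run q s′ U Q) → Run (seq p q) s (T + U) Q
  run-seq (ran e t≤T (ran e′ u≤U q)) = ran (seq e e′) (+-mono-≤ t≤T u≤U) q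

  -- Values are existential, so that a proof names them in simplified form and
  -- the terms describing later states stay small. A loop has no weakest
  -- precondition here; it is verified by run-for.
  wp : ∀ {r a} → Program r a → (State r a → Set) → State r a → Set
  wp skip Q s = Q s
  wp (set x o) Q ⟨ R , M ⟩ =
    ∃[ v ] (⟦ o ⟧ R ≡ v × v ≤ W × Q ⟨ R [ x ]≔ v , M ⟩)
  wp (arith x ⊕ o o′) Q ⟨ R , M ⟩ =
    ∃[ v ] (⟦ ⊕ ⟧ᵒ (⟦ o ⟧ R) (⟦ o′ ⟧ R) ≡ v × v ≤ W × Q ⟨ R [ x ]≔ v , M ⟩)
  wp (input x o) Q ⟨ R , M ⟩ =
    ∃[ v ] (At In (⟦ o ⟧ R) v × v ≤ W × Q ⟨ R [ x ]≔ v , M ⟩)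
  wp (load x A o) Q ⟨ R , M ⟩ =
    ∃[ v ] (lookup M A (⟦ o ⟧ R) ≡ v × ⟦ o ⟧ R < S × Q ⟨ R [ x ]≔ v , M ⟩)
  wp (store A o o′) Q ⟨ R , M ⟩ =
    ∃[ i ] ∃[ v ] (⟦ o ⟧ R ≡ i × ⟦ o′ ⟧ R ≡ v × i < S × v ≤ W ×
                   Q ⟨ R , M [ A ]≔ (lookup M A [ i ↦ v ]) ⟩)
  wp (seq p q) Q s = wp p (wp q Q) s
  wp (if< o o′ p q) Q s@(⟨ R , M ⟩) =
    (⟦ o ⟧ R < ⟦ o′ ⟧ R → wp p Q s) × (⟦ o′ ⟧ R ≤ ⟦ o ⟧ R → wp q Q s)
  wp (while< o o′ p) Q s = ⊥

  run-wp : ∀ {r a} (p : Program r a) {Q s} → wp p Q s → Run p s (cost p) Q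
  run-wp skip q = ran skip ≤-refl q
  run-wp (set x o) (_ , refl , w , q) = ran (set w) ≤-refl q
  run-wp (arith x ⊕ o o′) (_ , refl , w , q) = ran (arith w) ≤-refl q
  run-wp (input x o) (_ , found i o≡i refl , w , q) = ran (input i o≡i w) ≤-refl q
  run-wp (load x A o) (_ , refl , w , q) = ran (load w) ≤-refl q
  run-wp (store A o o′) (_ , _ , refl , refl , w , w′ , q) = ran (store w w′) ≤-refl q
  run-wp (seq p q) w = run-seq (run-weaken ≤-refl (run-wp q) (run-wp p w))
  run-wp (if< o o′ p q) {s = ⟨ R , M ⟩} (true-branch , false-branch) with ⟦ o ⟧ R <? ⟦ o′ ⟧ R
  ... | yes o<o′ with ran e t z ← run-wp p (true-branch o<o′) =
    ran (if-true o<o′ e) (s≤s (≤-trans t (m≤m⊔n _ _))) z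
  ... | no o≮o′ with ran e t z ← run-wp q (false-branch (≮⇒≥ o≮o′)) =
    ran (if-false (≮⇒≥ o≮o′) e) (s≤s (≤-trans t (m≤n⊔m (cost p) _))) z

  -- For branches that contain loops, which `run-wp` cannot enter.
  run-else : ∀ {r a} {o o′} {p q : Program r a} {s T Q} →
             ⟦ o′ ⟧ (State.registers s) ≤ ⟦ o ⟧ (State.registers s) →
             Run q s T Q → Run (if< o o′ p q) s (suc T) Q
  run-else {s = ⟨ R , M ⟩} o′≤o (ran e t≤T q) = ran (if-false o′≤o e) (s≤s t≤T) q

  -- The index of the invariant is read off the guard, so there are exactly `N` rounds. Each is
  -- charged `T` and its test; the outer `suc` pays for the last, failing test. The induction is on
  -- the number of rounds left.
  run-for : ∀ {r a} {o o′} {p : Program r a} (I : ℕ → State r a → Set) (T N : ℕ) →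
            (∀ {i s} → I i s →
               ⟦ o ⟧ (State.registers s) ≡ i × ⟦ o′ ⟧ (State.registers s) ≡ N) →
            (∀ {i s} → i < N → I i s → Run p s T (I (suc i))) →
            ∀ {s} → I 0 s → Run (while< o o′ p) s (suc (N * suc T)) (I N)
  run-for {o = o} {o′} {p} I T N guard body = go N refl
    where
    go : ∀ k {i s} → i + k ≡ N → I i s → Run (while< o o′ p) s (suc (k * suc T)) (I N)
    go zero {i} {⟨ R , M ⟩} eq inv with guard inv
    ... | o≡i , o′≡N =
      ran (while-false (≤-reflexive (trans o′≡N (trans (sym eq) (trans (+-identityʳ i) (sym o≡i))))))
          ≤-refl (subst (λ j → I j _) (trans (sym (+-identityʳ i)) eq) inv)
    go (suc k) {i} {⟨ R , M ⟩} eq inv with guard inv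
    ... | o≡i , o′≡N with i<N ← subst (i <_) eq (m<m+n i z<s)
      with ran e t inv′ ← body i<N inv
      with ran e′ t′ inv″ ← go k (trans (sym (+-suc i k)) eq) inv′ =
      ran (while-true (subst₂ _<_ (sym o≡i) (sym o′≡N) i<N) e e′)
          (s≤s (≤-trans (+-mono-≤ t t′) (≤-reflexive (+-suc T (k * suc T))))) inv″

-- Indicator sums and windows of predecessors

-- The Iverson bracket, used as a factor.
[_]·_ : ∀ {P : Set} → Dec P → ℕ → ℕ
[ P? ]· x = if does P? then x else 0

infix 8 [_]·_

·-true : ∀ {P : Set} (P? : Dec P) {x} → P → [ P? ]· x ≡ x
·-true (yes _) _ = refl
·-true (no ¬p) p = contradiction p ¬p

·-false : ∀ {P : Set} (P? : Dec P) {x} → ¬ P → [ P? ]· x ≡ 0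
·-false (yes p) ¬p = contradiction p ¬p
·-false (no _)  _  = refl

·-cong : ∀ {P Q : Set} (P? : Dec P) (Q? : Dec Q) {x y} →
         (P → Q) → (Q → P) → (P → x ≡ y) → [ P? ]· x ≡ [ Q? ]· y
·-cong (yes p) Q? P⇒Q _ x≡y = trans (x≡y p) (sym (·-true Q? (P⇒Q p)))
·-cong (no ¬p) Q? _ Q⇒P _   = sym (·-false Q? λ q → contradiction (Q⇒P q) ¬p)

∑< : ℕ → (ℕ → ℕ) → ℕ
∑< zero    f = 0
∑< (suc n) f = ∑< n f + f n

∑<-cong : ∀ n {f g} → (∀ i → i < n → f i ≡ g i) → ∑< n f ≡ ∑< n g
∑<-cong zero    f≡g = refl
∑<-cong (suc n) f≡g =
  cong₂ _+_ (∑<-cong n λ i i<n → f≡g i (m<n⇒m<1+n i<n)) (f≡g n ≤-refl)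

∑<-head : ∀ n f → ∑< (suc n) f ≡ f 0 + ∑< n (λ i → f (suc i))
∑<-head zero    f = +-comm 0 (f 0)
∑<-head (suc n) f =
  trans (cong (_+ f (suc n)) (∑<-head n f)) (+-assoc (f 0) _ _)

∑<-monoˡ : ∀ {m n} f → m ≤ n → ∑< m f ≤ ∑< n f
∑<-monoˡ {n = zero}  f z≤n = z≤n
∑<-monoˡ {n = suc n} f m≤n with m≤n⇒m<n∨m≡n m≤n
... | inj₁ (s≤s m≤n) = ≤-trans (∑<-monoˡ f m≤n) (m≤m+n _ _)
... | inj₂ refl      = ≤-refl

-- A window sum over the `e` positions just below `q`. Cutting it off at 0 makes it total, so that
-- every row of the table can have the same number of columns.
back : ℕ → ℕ → (ℕ → ℕ) → ℕ
back q       zero    f = 0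
back zero    (suc e) f = 0
back (suc q) (suc e) f = f q + back q e f

-- `back` recurses from the newest position, but a running count widens the window at its oldest
-- end; this exchanges the two.
back-extend : ∀ {q e} f → e < q → back q (suc e) f ≡ f (q ∸ suc e) + back q e f
back-extend {suc q} {zero}  f e<q = refl
back-extend {suc q} {suc e} f (s≤s e<q) = begin
  f q + back q (suc e) f                 ≡⟨ cong (f q +_) (back-extend f e<q) ⟩
  f q + (f (q ∸ suc e) + back q e f)     ≡⟨ sym (+-assoc (f q) _ _) ⟩
  f q + f (q ∸ suc e) + back q e f       ≡⟨ cong (_+ back q e f) (+-comm (f q) _) ⟩
  f (q ∸ suc e) + f q + back q e f       ≡⟨ +-assoc (f (q ∸ suc e)) (f q) _ ⟩
  f (q ∸ suc e) + (f q + back q e f)     ∎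
  where open ≡-Reasoning

back-saturated : ∀ {q e} f → q ≤ e → back q (suc e) f ≡ back q e f
back-saturated {zero}  {zero}  f q≤e       = refl
back-saturated {zero}  {suc e} f q≤e       = refl
back-saturated {suc q} {suc e} f (s≤s q≤e) = cong (f q +_) (back-saturated f q≤e)

back-bound : ∀ q e {f} → (∀ p → f p ≤ 1) → back q e f ≤ q
back-bound zero    zero    f≤1 = z≤n
back-bound zero    (suc e) f≤1 = z≤n
back-bound (suc q) zero    f≤1 = z≤n
back-bound (suc q) (suc e) f≤1 = +-mono-≤ (f≤1 q) (back-bound q e f≤1)

back-one : ∀ {q e} → e ≤ q → back q e (λ _ → 1) ≡ e
back-one z≤n       = refl
back-one (s≤s e≤q) = cong suc (back-one e≤q)

-- The bridge from positions selected by a property to tabulated windows. Dropping the newest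
-- position lowers `q` and `e` together and leaves the condition q ≤ p + e in the same form.
∑<-window : ∀ q e f {P : ℕ → Set} (P? : ∀ p → Dec (P p)) →
            (∀ p → p < q → P p → q ≤ p + e) → (∀ p → p < q → q ≤ p + e → P p) →
            ∑< q (λ p → [ P? p ]· f p) ≡ back q e f
∑<-window zero    zero    f P? to from = refl
∑<-window zero    (suc e) f P? to from = refl
∑<-window (suc q) zero    f P? to from = cong₂ _+_
  (∑<-window q zero f P?
    (λ p p<q Pp → ≤-trans (n≤1+n q) (to p (m<n⇒m<1+n p<q) Pp))
    (λ p p<q q≤p → contradiction (subst (q ≤_) (+-identityʳ p) q≤p) (<⇒≱ p<q)))
  (·-false (P? q) λ Pq →
    contradiction (subst (suc q ≤_) (+-identityʳ q) (to q ≤-refl Pq)) (<-irrefl refl))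
∑<-window (suc q) (suc e) f P? to from = begin
  ∑< q (λ p → [ P? p ]· f p) + [ P? q ]· f q
    ≡⟨ cong₂ _+_
         (∑<-window q e f P?
           (λ p p<q Pp → s≤s⁻¹ (subst (suc q ≤_) (+-suc p e) (to p (m<n⇒m<1+n p<q) Pp)))
           (λ p p<q q≤p → from p (m<n⇒m<1+n p<q) (subst (suc q ≤_) (sym (+-suc p e)) (s≤s q≤p))))
         (·-true (P? q) (from q ≤-refl (subst (suc q ≤_) (sym (+-suc q e)) (s≤s (m≤m+n q e))))) ⟩
  back q e f + f q ≡⟨ +-comm _ (f q) ⟩
  f q + back q e f ∎
  where open ≡-Reasoning

-- Paths of placements and the buckets they describe

-- cur and prev are the sizes of the current and of the previous bucket, idx is
-- the index of the current one.
record Placement : Set where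
  constructor placement
  field
    cur prev idx : ℕ

open Placement

grow fresh : Placement → Placement
grow  (placement a d b) = placement (suc a) d b
fresh (placement a d b) = placement 1 a (suc b)

-- `first` is demanded because `step` alone would let position 0 open bucket 1 and leave bucket 0
-- empty.
record Path (n : ℕ) (st : ℕ → Placement) : Set where
  field
    start : st 0 ≡ placement 0 0 0
    first : st 1 ≡ placement 1 0 0
    step  : ∀ q → q < n → st (suc q) ≡ grow (st q) ⊎ st (suc q) ≡ fresh (st q)

module _ {n st} (path : Path n st) where
  open Path path

  -- `st q` is the situation before position `q` is placed; its bucket is therefore read one index
  -- later.
  bucketAt : ℕ → ℕ
  bucketAt q = idx (st (suc q))

  cur≤ : ∀ q → q ≤ n → cur (st q) ≤ q
  cur≤ zero    _ rewrite start = ≤-refl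
  cur≤ (suc q) q<n with step q q<n
  ... | inj₁ eq rewrite eq = s≤s (cur≤ q (<⇒≤ q<n))
  ... | inj₂ eq rewrite eq = s≤s z≤n

  idx-step : ∀ q → q < n → idx (st q) ≤ bucketAt q × bucketAt q ≤ suc (idx (st q))
  idx-step q q<n with step q q<n
  ... | inj₁ eq rewrite eq = ≤-refl , n≤1+n _
  ... | inj₂ eq rewrite eq = n≤1+n _ , ≤-refl

  bucketAt-≤-idx : ∀ {p} q → q ≤ n → p < q → bucketAt p ≤ idx (st q)
  bucketAt-≤-idx (suc q) q<n p<1+q with m≤n⇒m<n∨m≡n p<1+q
  ... | inj₁ (s≤s p<q) with l , _ ← idx-step q q<n =
    ≤-trans (bucketAt-≤-idx q (<⇒≤ q<n) p<q) l
  ... | inj₂ refl = ≤-refl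

  bucketAt-mono : ∀ {p q} → q < n → p ≤ q → bucketAt p ≤ bucketAt q
  bucketAt-mono {q = q} q<n p≤q = bucketAt-≤-idx (suc q) q<n (s≤s p≤q)

  -- A discrete intermediate value argument: the index starts at 0 and rises by at most one per
  -- position.
  bucketAt-onto : ∀ q → q < n → ∀ {j} → j ≤ bucketAt q → ∃[ p ] (p ≤ q × bucketAt p ≡ j)
  bucketAt-onto zero q<n j≤ rewrite first = 0 , z≤n , trans (cong idx first) (sym (n≤0⇒n≡0 j≤))
  bucketAt-onto (suc q) q<n {j} j≤ with m≤n⇒m<n∨m≡n j≤
  ... | inj₂ refl = suc q , ≤-refl , refl
  ... | inj₁ j< with _ , u ← idx-step (suc q) q<n
    with p , p≤q , eq ← bucketAt-onto q (<⇒≤ q<n) (s≤s⁻¹ (≤-trans j< u)) =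
    p , m≤n⇒m≤1+n p≤q , eq

  current-window : ∀ q → q ≤ n → ∀ p → p < q →
    (idx (st q) ≤ bucketAt p → q ≤ p + cur (st q)) ×
    (q ≤ p + cur (st q) → idx (st q) ≤ bucketAt p)
  current-window (suc q) q<n p p<1+q with step q q<n | m≤n⇒m<n∨m≡n p<1+q
  ... | inj₁ eq | inj₁ (s≤s p<q) rewrite eq | +-suc p (cur (st q))
    with f , g ← current-window q (<⇒≤ q<n) p p<q = (λ h → s≤s (f h)) , (λ h → g (s≤s⁻¹ h))
  ... | inj₁ eq | inj₂ refl rewrite eq | +-suc p (cur (st q)) =
    (λ _ → s≤s (m≤m+n p _)) , (λ _ → ≤-refl)
  ... | inj₂ eq | inj₁ (s≤s p<q) rewrite eq | +-suc p 0 | +-identityʳ p =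
    (λ h → contradiction (≤-trans h (bucketAt-≤-idx q (<⇒≤ q<n) p<q)) (<-irrefl refl)) ,
    (λ h → contradiction (s≤s⁻¹ h) (<⇒≱ p<q))
  ... | inj₂ eq | inj₂ refl rewrite eq | +-suc p 0 | +-identityʳ p =
    (λ _ → ≤-refl) , (λ _ → ≤-refl)

  -- After `fresh` the two latest buckets are the new position and the former current bucket, so
  -- that case rests on `current-window` and not on the induction hypothesis.
  recent-window : ∀ q → q ≤ n → ∀ p → p < q →
    (idx (st q) ≤ suc (bucketAt p) → q ≤ p + (cur (st q) + prev (st q))) ×
    (q ≤ p + (cur (st q) + prev (st q)) → idx (st q) ≤ suc (bucketAt p))
  recent-window (suc q) q<n p p<1+q with step q q<n | m≤n⇒m<n∨m≡n p<1+q
  ... | inj₁ eq | inj₁ (s≤s p<q) rewrite eq | +-suc p (cur (st q) + prev (st q))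
    with f , g ← recent-window q (<⇒≤ q<n) p p<q = (λ h → s≤s (f h)) , (λ h → g (s≤s⁻¹ h))
  ... | inj₁ eq | inj₂ refl rewrite eq | +-suc p (cur (st q) + prev (st q)) =
    (λ _ → s≤s (m≤m+n p _)) , (λ _ → n≤1+n _)
  ... | inj₂ eq | inj₁ (s≤s p<q) rewrite eq | +-suc p (cur (st q))
    with f , g ← current-window q (<⇒≤ q<n) p p<q =
    (λ h → s≤s (f (s≤s⁻¹ h))) , (λ h → s≤s (g (s≤s⁻¹ h)))
  ... | inj₂ eq | inj₂ refl rewrite eq | +-suc p (cur (st q)) =
    (λ _ → s≤s (m≤m+n p _)) , (λ _ → n≤1+n _)

  current-count : ∀ q → q < n →
    ∑< (suc q) (λ p → [ bucketAt p ≟ bucketAt q ]· 1) ≡ cur (st (suc q))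
  current-count q q<n = trans
    (∑<-window (suc q) (cur (st (suc q))) (λ _ → 1) (λ p → bucketAt p ≟ bucketAt q)
      (λ p p<1+q eq → proj₁ (current-window (suc q) q<n p p<1+q) (≤-reflexive (sym eq)))
      (λ p p<1+q h → ≤-antisym (bucketAt-mono q<n (s≤s⁻¹ p<1+q))
                               (proj₂ (current-window (suc q) q<n p p<1+q) h)))
    (back-one (cur≤ (suc q) q<n))

  -- A bucket is measured at its last position, where the count equals `cur`; positions in other
  -- buckets leave the count unchanged.
  bucket-count-bound : ∀ {c} → (∀ q → q < n → cur (st (suc q)) ≤ c) →
    ∀ i q → q ≤ n → ∑< q (λ p → [ bucketAt p ≟ i ]· 1) ≤ c
  bucket-count-bound cur≤c i zero    q≤n = z≤n
  bucket-count-bound cur≤c i (suc q) q<n with bucketAt q ≟ i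
  ... | no ≢i rewrite ·-false (bucketAt q ≟ i) {1} ≢i | +-identityʳ (∑< q (λ p → [ bucketAt p ≟ i ]· 1)) =
    bucket-count-bound cur≤c i q (<⇒≤ q<n)
  ... | yes refl = ≤-trans (≤-reflexive (current-count q q<n)) (cur≤c q q<n)

-- The recurrence and its optimality

module Recurrence (n c : ℕ) (A : ℕ → ℕ → ℕ) where

  recent : ℕ → ℕ → ℕ
  recent q e = back q e (A q)

  opened : (ℕ → ℕ → ℕ) → ℕ → ℕ → ℕ
  opened f q a = recent q a + f 1 a

  extended : (ℕ → ℕ → ℕ) → ℕ → ℕ → ℕ → ℕ
  extended f q a d = recent q (a + d) + f (suc a) d

  -- On ties the current bucket is extended; in particular the first position
  -- stays in bucket 0, so that no bucket is empty.
  extends : (ℕ → ℕ → ℕ) → ℕ → ℕ → ℕ → Bool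
  extends f q a d = does (a <? c) ∧ does (opened f q a ≤? extended f q a d)

  better : (ℕ → ℕ → ℕ) → ℕ → ℕ → ℕ → ℕ
  better f q a d = if extends f q a d then extended f q a d else opened f q a

  -- best m a d is the largest number of further short edges that can be gained
  -- by placing the last m positions after buckets of sizes a (current) and d.
  best : ℕ → ℕ → ℕ → ℕ
  best zero    a d = 0
  best (suc m) a d = better (best m) (n ∸ suc m) a d

  opened≤better : ∀ f q a d → opened f q a ≤ better f q a d
  opened≤better f q a d with a <? c | opened f q a ≤? extended f q a d
  ... | no ≥ | _     rewrite dec-false (a <? c) ≥ = ≤-refl
  ... | yes < | yes ≤ rewrite dec-true (a <? c) < | dec-true (opened f q a ≤? extended f q a d) ≤ = ≤
  ... | yes < | no ≰ rewrite dec-true (a <? c) < | dec-false (opened f q a ≤? extended f q a d) ≰ = ≤-refl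

  extended≤better : ∀ f q {a} d → a < c → extended f q a d ≤ better f q a d
  extended≤better f q {a} d a<c rewrite dec-true (a <? c) a<c with opened f q a ≤? extended f q a d
  ... | yes ≤ rewrite dec-true (opened f q a ≤? extended f q a d) ≤ = ≤-refl
  ... | no ≰ rewrite dec-false (opened f q a ≤? extended f q a d) ≰ = ≰⇒≥ ≰

  advance : (ℕ → ℕ → ℕ) → ℕ → Placement → Placement
  advance f q s = if extends f q (cur s) (prev s) then grow s else fresh s

  optimal : ℕ → Placement
  optimal zero    = placement 0 0 0
  optimal (suc q) = advance (best (n ∸ suc q)) q (optimal q)

  -- One formula for both choices. The two latest buckets now include `q` itself, hence `pred`; what
  -- is left is a + d after `grow` and a after `fresh`, for the sizes a and d before the step.
  gain : (ℕ → Placement) → ℕ → ℕ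
  gain st q = recent q (pred (cur (st (suc q)) + prev (st (suc q))))

  best-step : ∀ {q} → q < n → ∀ a d → best (n ∸ q) a d ≡ better (best (n ∸ suc q)) q a d
  best-step {q} q<n a d = begin
    best (n ∸ q) a d                             ≡⟨ cong (λ m → best m a d) (∸-suc q<n) ⟩
    better (best (n ∸ suc q)) (n ∸ suc (n ∸ suc q)) a d
                                                 ≡⟨ cong (λ m → better (best (n ∸ suc q)) (n ∸ m) a d) (sym (∸-suc q<n)) ⟩
    better (best (n ∸ suc q)) (n ∸ (n ∸ q)) a d  ≡⟨ cong (λ m → better (best (n ∸ suc q)) m a d) (m∸[m∸n]≡n (<⇒≤ q<n)) ⟩
    better (best (n ∸ suc q)) q a d              ∎
    where
    open ≡-Reasoning
    ∸-suc : ∀ {q n} → q < n → n ∸ q ≡ suc (n ∸ suc q)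
    ∸-suc {zero}  {suc n} _ = refl
    ∸-suc {suc q} {suc n} (s≤s q<n) = ∸-suc q<n

  -- Never increases along a path, and is constant along the optimal one.
  potential : (ℕ → Placement) → ℕ → ℕ
  potential st q = ∑< q (gain st) + best (n ∸ q) (cur (st q)) (prev (st q))

  -- The potential starts at `best n 0 0`, cannot rise as long as buckets respect the capacity, and
  -- finally is at least the total gain.
  gain-bound : ∀ {st} → Path n st → (∀ q → q < n → cur (st (suc q)) ≤ c) →
               ∑< n (gain st) ≤ best n 0 0
  gain-bound {st} path cur≤c =
    ≤-trans (m≤m+n _ _) (≤-trans (descend n ≤-refl) (≤-reflexive (cong₂ (best n) (cong cur start) (cong prev start))))
    where
    open Path path
    descend-step : ∀ q → q < n → potential st (suc q) ≤ potential st q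
    descend-step q q<n rewrite best-step q<n (cur (st q)) (prev (st q))
                             | +-assoc (∑< q (gain st)) (gain st q) (best (n ∸ suc q) (cur (st (suc q))) (prev (st (suc q)))) =
      +-monoʳ-≤ (∑< q (gain st)) (local (step q q<n))
      where
      local : st (suc q) ≡ grow (st q) ⊎ st (suc q) ≡ fresh (st q) →
              gain st q + best (n ∸ suc q) (cur (st (suc q))) (prev (st (suc q)))
                ≤ better (best (n ∸ suc q)) q (cur (st q)) (prev (st q))
      local (inj₁ eq) with cur≤c q q<n
      ... | a<c rewrite eq = extended≤better (best (n ∸ suc q)) q (prev (st q)) a<c
      local (inj₂ eq) rewrite eq = opened≤better (best (n ∸ suc q)) q (cur (st q)) (prev (st q))
    descend : ∀ q → q ≤ n → potential st q ≤ potential st 0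
    descend zero    _   = ≤-refl
    descend (suc q) q<n = ≤-trans (descend-step q q<n) (descend q (<⇒≤ q<n))

  optimal-gain : ∑< n (gain optimal) ≡ best n 0 0
  optimal-gain = trans (trans (sym (+-identityʳ _)) (cong (λ m → ∑< n (gain optimal) + best m (cur (optimal n)) (prev (optimal n))) (sym (n∸n≡0 n))))
                       (constant n ≤-refl)
    where
    constant : ∀ q → q ≤ n → potential optimal q ≡ best n 0 0
    constant zero    _   = refl
    constant (suc q) q<n = trans (+-assoc (∑< q (gain optimal)) _ _)
      (trans (cong (∑< q (gain optimal) +_) local) (constant q (<⇒≤ q<n)))
      where
      local : gain optimal q + best (n ∸ suc q) (cur (optimal (suc q))) (prev (optimal (suc q)))
              ≡ best (n ∸ q) (cur (optimal q)) (prev (optimal q))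
      local rewrite best-step q<n (cur (optimal q)) (prev (optimal q))
        with extends (best (n ∸ suc q)) q (cur (optimal q)) (prev (optimal q))
      ... | true  = refl
      ... | false = refl

  optimal-path : 0 < c → Path n optimal
  optimal-path 0<c = record { start = refl ; first = first ; step = step }
    where
    first : optimal 1 ≡ placement 1 0 0
    first rewrite dec-true (0 <? c) 0<c
                | dec-true (opened (best (n ∸ 1)) 0 0 ≤? extended (best (n ∸ 1)) 0 0 0) ≤-refl = refl
    step : ∀ q → q < n → optimal (suc q) ≡ grow (optimal q) ⊎ optimal (suc q) ≡ fresh (optimal q)
    step q _ with extends (best (n ∸ suc q)) q (cur (optimal q)) (prev (optimal q))
    ... | true  = inj₁ refl
    ... | false = inj₂ refl

  -- `prev` is bounded as well because both sizes index the table when the arrangement is read off.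
  -- A newly opened bucket has size 1, which is where 0 < c enters.
  optimal-bounds : 0 < c → ∀ q → cur (optimal q) ≤ c × prev (optimal q) ≤ c
  optimal-bounds 0<c zero = z≤n , z≤n
  optimal-bounds 0<c (suc q) with optimal-bounds 0<c q | cur (optimal q) <? c
  ... | a≤c , d≤c | no ≮ rewrite dec-false (cur (optimal q) <? c) ≮ = 0<c , a≤c
  ... | a≤c , d≤c | yes a<c rewrite dec-true (cur (optimal q) <? c) a<c
    with does (opened (best (n ∸ suc q)) q (cur (optimal q)) ≤? extended (best (n ∸ suc q)) q (cur (optimal q)) (prev (optimal q)))
  ...   | true  = a<c , d≤c
  ...   | false = 0<c , a≤c

  module _ (A≤1 : ∀ q p → A q p ≤ 1) where

    recent-bound : ∀ q e → recent q e ≤ q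
    recent-bound q e = back-bound q e (A≤1 q)

    -- Enough to fit table entries into words: n * n is below the length of the input, which
    -- contains the adjacency matrix.
    best-bound : ∀ m a d → best m a d ≤ m * n
    best-bound zero    a d = z≤n
    best-bound (suc m) a d with extends (best m) (n ∸ suc m) a d
    ... | true  = +-mono-≤ (≤-trans (recent-bound _ (a + d)) (m∸n≤m n (suc m))) (best-bound m (suc a) d)
    ... | false = +-mono-≤ (≤-trans (recent-bound _ a) (m∸n≤m n (suc m))) (best-bound m 1 a)

-- Tables stored in row-major order

-- The completed table as a function of every flat address. The progress of filling is then a single
-- number, the address below which the array agrees with it.
grid : (ℕ → ℕ → ℕ) → (w : ℕ) .{{_ : NonZero w}} → ℕ → ℕ
grid f w p = f (p / w) (p % w)

grid-at : ∀ f w .{{_ : NonZero w}} x {y} → y < w → grid f w (x * w + y) ≡ f x y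
grid-at f w x {y} y<w = cong₂ f
  (trans (+-distrib-/-∣ˡ y (divides-refl x))
         (trans (cong₂ _+_ (m*n/n≡m x w) (m<n⇒m/n≡0 y<w)) (+-identityʳ x)))
  (trans (cong (_% w) (+-comm (x * w) y)) (trans ([m+kn]%n≡m%n y x w) (m<n⇒m%n≡m y<w)))

cube : (ℕ → ℕ → ℕ → ℕ) → (w : ℕ) .{{_ : NonZero w}} → ℕ → ℕ
cube f w = grid (λ xy z → grid (λ x y → f x y z) w xy) w

cube-at : ∀ f w .{{_ : NonZero w}} x {y z} → y < w → z < w →
          cube f w ((x * w + y) * w + z) ≡ f x y z
cube-at f w x {y} {z} y<w z<w =
  trans (grid-at (λ xy z → grid (λ x y → f x y z) w xy) w (x * w + y) z<w) (grid-at (λ x y → f x y z) w x y<w)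

grid-< : ∀ {x X y} w → x < X → y < w → x * w + y < X * w
grid-< {x} {X} {y} w x<X y<w = begin-strict
  x * w + y  <⟨ +-monoʳ-< (x * w) y<w ⟩
  x * w + w  ≡⟨ +-comm (x * w) w ⟩
  suc x * w  ≤⟨ *-monoˡ-≤ w x<X ⟩
  X * w      ∎
  where open ≤-Reasoning

update-same : ∀ A i {v} → (A [ i ↦ v ]) i ≡ v
update-same A i rewrite dec-true (i ≟ i) refl = refl

update-other : ∀ A {i j v} → ¬ j ≡ i → (A [ i ↦ v ]) j ≡ A j
update-other A {i} {j} j≢i rewrite dec-false (j ≟ i) j≢i = refl

AgreesBelow : ℕ → (ℕ → ℕ) → (ℕ → ℕ) → Set
AgreesBelow k A f = ∀ p → p < k → A p ≡ f p

append : ∀ {k A f v} → AgreesBelow k A f → v ≡ f k → AgreesBelow (suc k) (A [ k ↦ v ]) f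
append {k} {A} agrees v≡fk p p<1+k with m≤n⇒m<n∨m≡n p<1+k
... | inj₁ (s≤s p<k) = trans (update-other A (<⇒≢ p<k)) (agrees p p<k)
... | inj₂ refl      = trans (update-same A k) v≡fk

-- The program

infixr 4 _⨟_

_⨟_ : ∀ {r a} → Program r a → Program r a → Program r a
_⨟_ = seq

Reg : Set
Reg = Fin 14

-- In table-filling loops rd is also the column of the table of recent edge
-- counts and rbest the running count.
rn rc rC rL rq rm ra rd rbest rbit rx ry rt rb : Reg
rn = 0F
rc = 1F
rC = 2F
rL = 3F
rq = 4F
rm = 5F
ra = 6F
rd = 7F
rbest = 8F
rbit = 9F
rx = suc 9F
ry = suc (suc 9F)
rt = suc (suc (suc 9F))
rb = suc (suc (suc (suc 9F)))

aOut aRecent aBest : Fin 3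
aOut = 0F
aRecent = 1F
aBest = 2F

inc : Reg → Program 14 3
inc x = arith x add (lit 1) (reg x)

-- Shared by the filling of the table and the reading off of the arrangement: the choice is
-- recomputed from two entries of the next layer, so no choices are stored.
evaluate extendCode : Program 14 3
extendCode =
  arith rx add (reg ra) (reg rd) ⨟
  arith rt mul (reg rq) (reg rL) ⨟
  arith rt add (reg rt) (reg rx) ⨟
  load rx aRecent (reg rt) ⨟
  arith rt mul (reg rm) (reg rC) ⨟
  arith ry add (lit 1) (reg ra) ⨟
  arith rt add (reg rt) (reg ry) ⨟
  arith rt mul (reg rt) (reg rC) ⨟
  arith rt add (reg rt) (reg rd) ⨟
  load ry aBest (reg rt) ⨟
  arith rx add (reg rx) (reg ry) ⨟
  -- The strict test gives ties to extension, as `extends` does.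
  if< (reg rx) (reg rbest) skip (set rbest (reg rx) ⨟ set rbit (lit 1))
evaluate =
  arith rt mul (reg rq) (reg rL) ⨟
  arith rt add (reg rt) (reg ra) ⨟
  load rx aRecent (reg rt) ⨟
  arith rt mul (reg rm) (reg rC) ⨟
  arith rt add (reg rt) (lit 1) ⨟
  arith rt mul (reg rt) (reg rC) ⨟
  arith rt add (reg rt) (reg ra) ⨟
  load ry aBest (reg rt) ⨟
  arith rbest add (reg rx) (reg ry) ⨟
  set rbit (lit 0) ⨟
  if< (reg ra) (reg rc) extendCode skip

recentCell recentRowStart recentRow : Program 14 3
recentCell =
  arith rt mul (reg rq) (reg rL) ⨟
  arith rt add (reg rt) (reg rd) ⨟
  store aRecent (reg rt) (reg rbest) ⨟
  if< (reg rd) (reg rq)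
    (arith rt sub (reg rq) (reg rd) ⨟
     -- The vertex at position q - e - 1 is in input cell 2 + (q - e - 1) = 1 + (q - e), where e is
     -- the column.
     arith rt add (lit 1) (reg rt) ⨟
     input ry (reg rt) ⨟
     arith rt add (reg rx) (reg ry) ⨟
     input rt (reg rt) ⨟
     arith rbest add (reg rt) (reg rbest))
    skip ⨟
  inc rd
recentRowStart =
  arith rt add (lit 2) (reg rq) ⨟
  input rx (reg rt) ⨟
  -- The start of the adjacency row: two parameters and the n cells of the ordering precede the
  -- matrix.
  arith rx mul (reg rx) (reg rn) ⨟
  arith rx add (reg rn) (reg rx) ⨟
  arith rx add (lit 2) (reg rx) ⨟
  set rbest (lit 0) ⨟
  set rd (lit 0)
recentRow = recentRowStart ⨟ while< (reg rd) (reg rL) recentCell ⨟ inc rq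

writeBest bestCell bestColumn bestRow : Program 14 3
writeBest =
  arith ry add (lit 1) (reg rm) ⨟
  arith rt mul (reg ry) (reg rC) ⨟
  arith rt add (reg rt) (reg ra) ⨟
  arith rt mul (reg rt) (reg rC) ⨟
  arith rt add (reg rt) (reg rd) ⨟
  store aBest (reg rt) (reg rbest) ⨟
  inc rd
bestCell = evaluate ⨟ writeBest
bestColumn = set rd (lit 0) ⨟ while< (reg rd) (reg rC) bestCell ⨟ inc ra
bestRow =
  (arith rt add (lit 1) (reg rm) ⨟ arith rq sub (reg rn) (reg rt) ⨟ set ra (lit 0)) ⨟
  while< (reg ra) (reg rC) bestColumn ⨟
  inc rm

assign writeBucket place : Program 14 3
assign =
  if< (lit 0) (reg rbit)
    (inc ra)
    (set rd (reg ra) ⨟ set ra (lit 1) ⨟ inc rb)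
writeBucket =
  arith rt add (lit 2) (reg rq) ⨟
  input ry (reg rt) ⨟
  arith ry add (lit 2) (reg ry) ⨟
  store aOut (reg ry) (reg rb) ⨟
  inc rq
place =
  arith rt add (lit 1) (reg rq) ⨟
  arith rm sub (reg rn) (reg rt) ⨟
  evaluate ⨟
  assign ⨟
  writeBucket

start restart finish solve readParameters dispatch main : Program 14 3
start = arith rC add (lit 1) (reg rc) ⨟ arith rL add (reg rC) (reg rc) ⨟ set rq (lit 0)
restart = set rq (lit 0) ⨟ set ra (lit 0) ⨟ set rd (lit 0) ⨟ set rb (lit 0)
finish = inc rb ⨟ store aOut (lit 1) (reg rb) ⨟ store aOut (lit 0) (lit 1)
solve =
  start ⨟
  while< (reg rq) (reg rn) recentRow ⨟
  set rm (lit 0) ⨟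
  while< (reg rm) (reg rn) bestRow ⨟
  restart ⨟
  while< (reg rq) (reg rn) place ⨟
  finish
readParameters = input rn (lit 0) ⨟ input rc (lit 1)
-- Arrays start as zeros, so the infeasible case writes nothing, and the empty graph writes only the
-- flag because its bucket count 0 is already in place.
dispatch = if< (reg rn) (lit 1) (store aOut (lit 0) (lit 1)) (if< (reg rc) (lit 1) skip solve)
main = readParameters ⨟ dispatch

timeRecentRow timeBestColumn timeBestRow : ℕ → ℕ
timeRecentRow L = cost recentRowStart + (suc (L * suc (cost recentCell)) + 1)
timeBestColumn C = 1 + (suc (C * suc (cost bestCell)) + 1)
timeBestRow C = 3 + (suc (C * suc (timeBestColumn C)) + 1)

timeSolve : ℕ → ℕ → ℕ
timeSolve n c =
  3 + (suc (n * suc (timeRecentRow (suc (c + c)))) +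
  (1 + (suc (n * suc (timeBestRow (suc c))) +
  (4 + (suc (n * suc (cost place)) + 3)))))

-- Verification of the program

-- The instance enters only through functions on numbers and facts about input cells, so this part
-- is free of graphs and permutations.
module Correctness
  (n c : ℕ) (0<n : 0 < n) (0<c : 0 < c)
  (A : ℕ → ℕ → ℕ) (A≤1 : ∀ q p → A q p ≤ 1)
  (vert : ℕ → ℕ) (vert<n : ∀ {p} → p < n → vert p < n)
  (vert-injective : ∀ {p q} → p < n → q < n → vert p ≡ vert q → p ≡ q)
  (W : ℕ) (In : List ℕ)
  (space≤W : suc n * suc c * suc c ≤ W) (length≤W : 2 + (n + n * n) ≤ W)
  (at-vert : ∀ {p} → p < n → At In (2 + p) (vert p))
  (at-adj : ∀ {q p} → q < n → p < n → At In (2 + (n + vert q * n + vert p)) (A q p))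
  where

  open Recurrence n c A

  -- Bucket sizes range over 0..c and windows over 0..2c. `S` is the size of the table of `best` and
  -- serves all three arrays: 2c + 1 ≤ (c + 1)^2 makes room for the recent counts, and c ≥ 1 for the
  -- n + 2 output cells.
  C L S : ℕ
  C = suc c
  L = suc (c + c)
  S = suc n * C * C

  open Logic W S In

  mk : (q m a d best bit x y t b : ℕ) (out D R : ℕ → ℕ) → State 14 3
  mk q m a d best bit x y t b out D R =
    ⟨ n ∷ c ∷ C ∷ L ∷ q ∷ m ∷ a ∷ d ∷ best ∷ bit ∷ x ∷ y ∷ t ∷ b ∷ [] , out ∷ D ∷ R ∷ [] ⟩

  run-step : ∀ {p q : Program 14 3} {s U Q} →
             wp p (λ s′ → Run q s′ U Q) s → Run (seq p q) s (cost p + U) Q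
  run-step {p} w = run-seq (run-wp p w)

  run-then : ∀ {p q : Program 14 3} {s T U Q P} → Run p s T P →
             (∀ {s′} → P s′ → Run q s′ U Q) → Run (seq p q) s (T + U) Q
  run-then r f = run-seq (run-weaken ≤-refl f r)

  <S⇒≤W : ∀ {v} → v < S → v ≤ W
  <S⇒≤W v<S = ≤-trans (<⇒≤ v<S) space≤W

  n+2≤S : 2 + n ≤ S
  n+2≤S = begin
    2 + n              ≡⟨ +-comm 1 (suc n) ⟩
    suc n + 1          ≤⟨ +-monoʳ-≤ (suc n) (≤-trans (s≤s z≤n) (m≤m+n (suc n) 0)) ⟩
    2 * suc n          ≡⟨ *-comm 2 (suc n) ⟩
    suc n * 2          ≤⟨ *-monoʳ-≤ (suc n) (s≤s 0<c) ⟩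
    suc n * C          ≤⟨ m≤m*n (suc n * C) C ⟩
    S                  ∎
    where open ≤-Reasoning

  small : ∀ {v} → v ≤ 2 + n → v ≤ W
  small v≤ = ≤-trans v≤ (≤-trans n+2≤S space≤W)

  C≤W : C ≤ W
  C≤W = ≤-trans (m≤n*m C (suc n * C)) space≤W

  L≤C*C : L ≤ C * C
  L≤C*C = s≤s (+-monoʳ-≤ c (≤-trans (m≤m*n c C) ≤-refl))

  L≤S : L ≤ S
  L≤S = ≤-trans L≤C*C (≤-trans (m≤n*m (C * C) (suc n)) (≤-reflexive (sym (*-assoc (suc n) C C))))

  address₂ : ∀ {q e} → q < n → e < L → q * L + e < S
  address₂ {q} {e} q<n e<L = begin-strict
    q * L + e      <⟨ grid-< L q<n e<L ⟩
    n * L          ≤⟨ *-mono-≤ (n≤1+n n) L≤C*C ⟩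
    suc n * (C * C) ≡⟨ sym (*-assoc (suc n) C C) ⟩
    S              ∎
    where open ≤-Reasoning

  address₃ : ∀ {m a d} → m ≤ n → a ≤ c → d ≤ c → (m * C + a) * C + d < S
  address₃ m≤n a≤c d≤c = grid-< C (grid-< C (s≤s m≤n) (s≤s a≤c)) (s≤s d≤c)

  value : ∀ {q m} e a d → q ≤ n → m ≤ n → recent q e + best m a d ≤ W
  value {q} {m} e a d q≤n m≤n = ≤-trans
    (+-mono-≤ (≤-trans (recent-bound A≤1 q e) q≤n)
              (≤-trans (best-bound A≤1 m a d) (*-monoˡ-≤ n m≤n)))
    (≤-trans (m≤n+m _ 2) length≤W)

  ≤-address : ∀ {v w} → v < S → w ≤ v → w ≤ W
  ≤-address v<S w≤v = <S⇒≤W (≤-<-trans w≤v v<S)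

  RecentTable : (ℕ → ℕ) → Set
  RecentTable D = ∀ {q e} → q < n → e < L → D (q * L + e) ≡ recent q e

  BestRow : ℕ → (ℕ → ℕ) → Set
  BestRow m R = ∀ {a d} → a ≤ c → d ≤ c → R ((m * C + a) * C + d) ≡ best m a d

  choiceBit : ℕ → ℕ → ℕ → ℕ → ℕ
  choiceBit m q a d = if extends (best m) q a d then 1 else 0

  -- The arbitrary `Q` lets this be spliced into the precondition of a longer program. Scratch
  -- registers are generalised in `post`, which keeps later state terms small.
  extendCode-wp : ∀ {q m a d bst bit x y t b out D R Q} →
    q < n → m ≤ n → a < c → d ≤ c → RecentTable D → BestRow m R →
    (∀ {bst′ bit′ x′ y′ t′} →
       bst′ ≡ (if does (bst ≤? extended (best m) q a d) then extended (best m) q a d else bst) →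
       bit′ ≡ (if does (bst ≤? extended (best m) q a d) then 1 else bit) →
       Q (mk q m a d bst′ bit′ x′ y′ t′ b out D R)) →
    wp extendCode Q (mk q m a d bst bit x y t b out D R)
  extendCode-wp {q} {m} {a} {d} {bst} {Q = Q} q<n m≤n a<c d≤c Dok Rok post =
    a + d , refl , ≤-address addrD (m≤n+m _ (q * L)) ,
    q * L , refl , ≤-address addrD (m≤m+n _ (a + d)) ,
    q * L + (a + d) , refl , <S⇒≤W addrD ,
    recent q (a + d) , Dok q<n (s≤s (+-mono-≤ (<⇒≤ a<c) d≤c)) , addrD ,
    m * C , refl , ≤-address addrR′ (m≤m+n _ (suc a)) ,
    suc a , refl , ≤-address addrR′ (m≤n+m _ (m * C)) ,
    m * C + suc a , refl , <S⇒≤W addrR′ ,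
    (m * C + suc a) * C , refl , ≤-address addrR (m≤m+n _ d) ,
    (m * C + suc a) * C + d , refl , <S⇒≤W addrR ,
    best m (suc a) d , Rok a<c d≤c , addrR ,
    extended (best m) q a d , refl , bounded ,
    (λ < → post (sym (if-no <)) (sym (if-no <))) ,
    (λ ≥ → extended (best m) q a d , refl , bounded , 1 , refl , ≤-trans (s≤s z≤n) C≤W ,
           post (sym (if-yes ≥)) (sym (if-yes ≥)))
    where
    addrD : q * L + (a + d) < S
    addrD = address₂ q<n (s≤s (+-mono-≤ (<⇒≤ a<c) d≤c))
    addrR : (m * C + suc a) * C + d < S
    addrR = address₃ m≤n a<c d≤c
    addrR′ : m * C + suc a < S
    addrR′ = ≤-<-trans (≤-trans (m≤m*n (m * C + suc a) C) (m≤m+n _ d)) addrR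
    bounded : extended (best m) q a d ≤ W
    bounded = value (a + d) (suc a) d (<⇒≤ q<n) m≤n
    if-no : ∀ {u v : ℕ} → extended (best m) q a d < bst →
            (if does (bst ≤? extended (best m) q a d) then u else v) ≡ v
    if-no < rewrite dec-false (bst ≤? extended (best m) q a d) (<⇒≱ <) = refl
    if-yes : ∀ {u v : ℕ} → bst ≤ extended (best m) q a d →
            (if does (bst ≤? extended (best m) q a d) then u else v) ≡ u
    if-yes ≥ rewrite dec-true (bst ≤? extended (best m) q a d) ≥ = refl

  evaluate-wp : ∀ {q m a d bst bit x y t b out D R Q} →
    q < n → m ≤ n → a ≤ c → d ≤ c → RecentTable D → BestRow m R →
    (∀ {bst′ bit′ x′ y′ t′} → bst′ ≡ better (best m) q a d → bit′ ≡ choiceBit m q a d →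
       Q (mk q m a d bst′ bit′ x′ y′ t′ b out D R)) →
    wp evaluate Q (mk q m a d bst bit x y t b out D R)
  evaluate-wp {q} {m} {a} {d} {Q = Q} q<n m≤n a≤c d≤c Dok Rok post =
    q * L , refl , ≤-address addrD (m≤m+n _ a) ,
    q * L + a , refl , <S⇒≤W addrD ,
    recent q a , Dok q<n (s≤s (≤-trans a≤c (m≤m+n c c))) , addrD ,
    m * C , refl , ≤-address addrR′ (m≤m+n _ 1) ,
    m * C + 1 , refl , <S⇒≤W addrR′ ,
    (m * C + 1) * C , refl , ≤-address addrR (m≤m+n _ a) ,
    (m * C + 1) * C + a , refl , <S⇒≤W addrR ,
    best m 1 a , Rok 0<c a≤c , addrR ,
    opened (best m) q a , refl , value a 1 a (<⇒≤ q<n) m≤n ,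
    0 , refl , z≤n ,
    (λ a<c → extendCode-wp {x = recent q a} {best m 1 a} {(m * C + 1) * C + a} {Q = Q} q<n m≤n a<c d≤c Dok Rok λ bst≡ bit≡ →
       post (trans bst≡ (sym (unfold-better a<c))) (trans bit≡ (sym (unfold-bit a<c)))) ,
    (λ c≤a → post (sym (full-better c≤a)) (sym (full-bit c≤a)))
    where
    addrD : q * L + a < S
    addrD = address₂ q<n (s≤s (≤-trans a≤c (m≤m+n c c)))
    addrR : (m * C + 1) * C + a < S
    addrR = address₃ m≤n 0<c a≤c
    addrR′ : m * C + 1 < S
    addrR′ = ≤-<-trans (≤-trans (m≤m*n (m * C + 1) C) (m≤m+n _ a)) addrR
    ok? : Dec (opened (best m) q a ≤ extended (best m) q a d)
    ok? = opened (best m) q a ≤? extended (best m) q a d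
    unfold-better : a < c → better (best m) q a d
                    ≡ (if does ok? then extended (best m) q a d else opened (best m) q a)
    unfold-better a<c rewrite dec-true (a <? c) a<c = refl
    unfold-bit : a < c → choiceBit m q a d ≡ (if does ok? then 1 else 0)
    unfold-bit a<c rewrite dec-true (a <? c) a<c = refl
    full-better : c ≤ a → better (best m) q a d ≡ opened (best m) q a
    full-better c≤a rewrite dec-false (a <? c) (≤⇒≯ c≤a) = refl
    full-bit : c ≤ a → choiceBit m q a d ≡ 0
    full-bit c≤a rewrite dec-false (a <? c) (≤⇒≯ c≤a) = refl

  zeros : ℕ → ℕ
  zeros _ = 0

  -- Registers that do not matter are hidden by the constructor. The third array is kept as `zeros`,
  -- which later supplies layer 0 of the table of `best`.
  data RecentRows (q : ℕ) : State 14 3 → Set where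
    recentRows : ∀ {m a d bst bit x y t b D} → AgreesBelow (q * L) D (grid recent L) →
                 RecentRows q (mk q m a d bst bit x y t b zeros D zeros)

  data RecentCells (q e : ℕ) : State 14 3 → Set where
    recentCells : ∀ {m a bst bit y t b D} → bst ≡ recent q e →
                  AgreesBelow (q * L + e) D (grid recent L) →
                  RecentCells q e (mk q m a e bst bit (2 + (n + vert q * n)) y t b zeros D zeros)

  square≤W : ∀ {u v} → u < n → v < n → 2 + (n + u * n + v) ≤ W
  square≤W {u} {v} u<n v<n = ≤-trans (+-monoʳ-≤ 2 (begin
    n + u * n + v    ≡⟨ +-assoc n (u * n) v ⟩
    n + (u * n + v)  ≤⟨ +-monoʳ-≤ n (<⇒≤ (grid-< n u<n v<n)) ⟩
    n + n * n        ∎)) length≤W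
    where open ≤-Reasoning

  1≤W : 1 ≤ W
  1≤W = small (s≤s z≤n)

  run-recentCell : ∀ {q e s} → q < n → e < L → RecentCells q e s →
                   Run recentCell s (cost recentCell) (RecentCells q (suc e))
  run-recentCell {q} {e} q<n e<L (recentCells {D = D} refl agrees) = run-wp recentCell (
    q * L , refl , ≤-address addr (m≤m+n _ e) ,
    q * L + e , refl , <S⇒≤W addr ,
    q * L + e , recent q e , refl , refl , addr , recent≤W e ,
    (λ e<q →
      q ∸ e , refl , small (≤-trans (m∸n≤m q e) q≤2+n) ,
      suc (q ∸ e) , refl , small (≤-trans (s≤s (m∸n≤m q e)) (≤-trans q<n (m≤n+m n 2))) ,
      vert (p e) , subst (λ k → At In (suc k) (vert (p e))) (sym (+-∸-assoc 1 e<q)) (at-vert (p<n e)) ,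
        small (≤-trans (<⇒≤ (vert<n (p<n e))) (m≤n+m n 2)) ,
      2 + (n + vert q * n + vert (p e)) , refl , square≤W (vert<n q<n) (vert<n (p<n e)) ,
      A q (p e) , at-adj q<n (p<n e) , ≤-trans (A≤1 q (p e)) 1≤W ,
      recent q (suc e) , sym (back-extend (A q) e<q) , recent≤W (suc e) ,
      suc e , refl , e≤W , recentCells refl written) ,
    (λ q≤e → suc e , refl , e≤W , recentCells (sym (back-saturated (A q) q≤e)) written))
    where
    p : ℕ → ℕ
    p e = q ∸ suc e
    q≤2+n = ≤-trans (<⇒≤ q<n) (m≤n+m n 2)
    p<n : ∀ e → p e < n
    p<n e = ≤-<-trans (m∸n≤m q (suc e)) q<n
    addr : q * L + e < S
    addr = address₂ q<n e<L
    recent≤W : ∀ e → recent q e ≤ W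
    recent≤W e = small (≤-trans (recent-bound A≤1 q e) q≤2+n)
    e≤W : suc e ≤ W
    e≤W = ≤-trans e<L (≤-trans L≤S space≤W)
    written : AgreesBelow (q * L + suc e) (D [ q * L + e ↦ recent q e ]) (grid recent L)
    written rewrite +-suc (q * L) e = append agrees (sym (grid-at recent L q e<L))

  run-recentRow : ∀ {q s} → q < n → RecentRows q s →
                  Run recentRow s (timeRecentRow L) (RecentRows (suc q))
  run-recentRow {q} q<n (recentRows {D = D} agrees) = run-step (
    2 + q , refl , small (s≤s (≤-trans q<n (n≤1+n n))) ,
    vert q , at-vert q<n , small (≤-trans (<⇒≤ vq<n) (m≤n+m n 2)) ,
    vert q * n , refl , ≤-trans (≤-trans (m≤n+m _ n) (m≤n+m _ 2)) base≤W ,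
    n + vert q * n , refl , ≤-trans (m≤n+m _ 2) base≤W ,
    2 + (n + vert q * n) , refl , base≤W ,
    0 , refl , z≤n , 0 , refl , z≤n ,
    run-then (run-for (RecentCells q) (cost recentCell) L
                (λ { (recentCells _ _) → refl , refl }) (run-recentCell q<n)
                (recentCells refl (subst (λ k → AgreesBelow k D (grid recent L)) (sym (+-identityʳ (q * L))) agrees)))
      λ { (recentCells {D = D} _ agrees′) → run-wp (inc rq)
          (suc q , refl , small (≤-trans q<n (m≤n+m n 2)) ,
           recentRows (subst (λ k → AgreesBelow k D (grid recent L)) (+-comm (q * L) L) agrees′)) })
    where
    vq<n = vert<n q<n
    base≤W : 2 + (n + vert q * n) ≤ W
    base≤W = ≤-trans (+-monoʳ-≤ 2 (m≤m+n _ 0)) (square≤W vq<n 0<n)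

  recent-table : ∀ {D} → AgreesBelow (n * L) D (grid recent L) → RecentTable D
  recent-table agrees {q} {e} q<n e<L =
    trans (agrees _ (grid-< L q<n e<L)) (grid-at recent L q e<L)

  best-row : ∀ {k R} m → AgreesBelow k R (cube best C) → suc m * C * C ≤ k → BestRow m R
  best-row m agrees ≤k {a} {d} a≤c d≤c =
    trans (agrees _ (<-≤-trans (grid-< C (grid-< C (n<1+n m) (s≤s a≤c)) (s≤s d≤c)) ≤k))
          (cube-at best C m (s≤s a≤c) (s≤s d≤c))

  data BestRows (D : ℕ → ℕ) (m : ℕ) : State 14 3 → Set where
    bestRows : ∀ {q a d bst bit x y t b R} → AgreesBelow (suc m * C * C) R (cube best C) →
               BestRows D m (mk q m a d bst bit x y t b zeros D R)

  data BestColumns (D : ℕ → ℕ) (m a : ℕ) : State 14 3 → Set where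
    bestColumns : ∀ {d bst bit x y t b R} → AgreesBelow ((suc m * C + a) * C) R (cube best C) →
                  BestColumns D m a (mk (n ∸ suc m) m a d bst bit x y t b zeros D R)

  data BestCells (D : ℕ → ℕ) (m a d : ℕ) : State 14 3 → Set where
    bestCells : ∀ {bst bit x y t b R} → AgreesBelow ((suc m * C + a) * C + d) R (cube best C) →
                BestCells D m a d (mk (n ∸ suc m) m a d bst bit x y t b zeros D R)

  subst-agrees : ∀ {k l A f} → k ≡ l → AgreesBelow k A f → AgreesBelow l A f
  subst-agrees refl agrees = agrees

  run-bestCell : ∀ {D m a d s} → RecentTable D → m < n → a < C → d < C → BestCells D m a d s →
                 Run bestCell s (cost bestCell) (BestCells D m a (suc d))
  run-bestCell {D} {m} {a} {d} Dok m<n a<C d<C (bestCells {bst} {bit} {x} {y} {t} {R = R} agrees) = run-wp bestCell (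
    evaluate-wp {bst = bst} {bit} {x} {y} {t} {Q = wp writeBest (BestCells D m a (suc d))} q<n (<⇒≤ m<n) (s≤s⁻¹ a<C) (s≤s⁻¹ d<C) Dok
      -- The filled part already reaches layer m + 1, so layer m, the only one read here, is
      -- complete.
      (best-row m agrees (≤-trans (*-monoˡ-≤ C (m≤m+n (suc m * C) a)) (m≤m+n _ d))) λ { refl _ →
    suc m , refl , small (≤-trans m<n (m≤n+m n 2)) ,
    suc m * C , refl , ≤-address addr′ (m≤m+n _ a) ,
    suc m * C + a , refl , <S⇒≤W addr′ ,
    (suc m * C + a) * C , refl , ≤-address addr (m≤m+n _ d) ,
    (suc m * C + a) * C + d , refl , <S⇒≤W addr ,
    -- Register `rq` holds n ∸ suc m, so the computed `better` is `best (suc m) a d` by definition.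
    (suc m * C + a) * C + d , best (suc m) a d , refl , refl , addr ,
      ≤-trans (best-bound A≤1 (suc m) a d) (≤-trans (*-monoˡ-≤ n m<n) (≤-trans (m≤n+m _ (2 + n)) length≤W)) ,
    suc d , refl , ≤-trans d<C C≤W ,
    bestCells (subst-agrees (sym (+-suc ((suc m * C + a) * C) d))
                (append agrees (sym (cube-at best C (suc m) a<C d<C)))) })
    where
    q<n : n ∸ suc m < n
    q<n = ∸-monoʳ-< z<s m<n
    addr : (suc m * C + a) * C + d < S
    addr = address₃ m<n (s≤s⁻¹ a<C) (s≤s⁻¹ d<C)
    addr′ : suc m * C + a < S
    addr′ = ≤-<-trans (≤-trans (m≤m*n (suc m * C + a) C) (m≤m+n _ d)) addr

  run-bestColumn : ∀ {D m a s} → RecentTable D → m < n → a < C → BestColumns D m a s →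
                   Run bestColumn s (timeBestColumn C) (BestColumns D m (suc a))
  run-bestColumn {D} {m} {a} Dok m<n a<C (bestColumns agrees) = run-step (
    0 , refl , z≤n ,
    run-then (run-for (BestCells D m a) (cost bestCell) C
               (λ { (bestCells _) → refl , refl }) (run-bestCell Dok m<n a<C)
               (bestCells (subst-agrees (sym (+-identityʳ ((suc m * C + a) * C))) agrees)))
      λ { (bestCells agrees′) → run-wp (inc ra)
          (suc a , refl , ≤-trans a<C C≤W , bestColumns {D = D} {m} {suc a} (subst-agrees (column≡ (suc m * C)) agrees′)) })
    where
    column≡ : ∀ x → (x + a) * C + C ≡ (x + suc a) * C
    column≡ x = trans (+-comm _ C) (cong (_* C) (sym (+-suc x a)))

  run-bestRow : ∀ {D m s} → RecentTable D → m < n → BestRows D m s →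
                Run bestRow s (timeBestRow C) (BestRows D (suc m))
  run-bestRow {D} {m} Dok m<n (bestRows agrees) = run-step (
    suc m , refl , small (≤-trans m<n (m≤n+m n 2)) ,
    n ∸ suc m , refl , small (≤-trans (m∸n≤m n (suc m)) (m≤n+m n 2)) ,
    0 , refl , z≤n ,
    run-then (run-for (BestColumns D m) (timeBestColumn C) C
               (λ { (bestColumns _) → refl , refl }) (run-bestColumn Dok m<n)
               (bestColumns (subst-agrees (cong (_* C) (sym (+-identityʳ (suc m * C)))) agrees)))
      λ { (bestColumns agrees′) → run-wp (inc rm)
          (suc m , refl , small (≤-trans m<n (m≤n+m n 2)) ,
           bestRows (subst-agrees (cong (_* C) (+-comm (suc m * C) C)) agrees′)) })

  bucketOf : ℕ → ℕ
  bucketOf p = idx (optimal (suc p))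

  Written : ℕ → (ℕ → ℕ) → Set
  Written q out = ∀ {p} → p < q → out (2 + vert p) ≡ bucketOf p

  data Placed (D R : ℕ → ℕ) (q : ℕ) : State 14 3 → Set where
    placed : ∀ {m a d bst bit x y t b out} → placement a d b ≡ optimal q → b ≤ q → Written q out →
             Placed D R q (mk q m a d bst bit x y t b out D R)

  run-place : ∀ {D R q s} → RecentTable D → (∀ {m} → m ≤ n → BestRow m R) → q < n →
              Placed D R q s → Run place s (cost place) (Placed D R (suc q))
  run-place {D} {R} {q} Dok Rok q<n (placed {a = a} {d} {bst} {bit} {x} {y} {b = b} {out} state b≤q written) = run-wp place (
    suc q , refl , small (≤-trans q<n (m≤n+m n 2)) ,
    n ∸ suc q , refl , small (≤-trans m≤n (m≤n+m n 2)) ,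
    evaluate-wp {bst = bst} {bit} {x} {y} {suc q} {Q = wp (assign ⨟ writeBucket) (Placed D R (suc q))} q<n m≤n a≤c d≤c Dok (Rok m≤n) λ {_} {_} {_} {y′} {t′} _ bit≡ →
    (λ 0<bit → suc a , refl , ≤-trans (s≤s a≤c) C≤W ,
               emit (suc a) d b y′ t′ (grows (subst (0 <_) bit≡ 0<bit)) (m≤n⇒m≤1+n b≤q)) ,
    (λ bit≤0 → a , refl , ≤-trans a≤c (≤-trans (n≤1+n c) C≤W) , 1 , refl , 1≤W ,
               suc b , refl , small (≤-trans (≤-trans (s≤s b≤q) q<n) (m≤n+m n 2)) ,
               emit 1 a (suc b) y′ t′ (opens (subst (_≤ 0) bit≡ bit≤0)) (s≤s b≤q)))
    where
    m≤n : n ∸ suc q ≤ n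
    m≤n = m∸n≤m n (suc q)
    a≤c : a ≤ c
    a≤c = subst (λ s → cur s ≤ c) (sym state) (proj₁ (optimal-bounds 0<c q))
    d≤c : d ≤ c
    d≤c = subst (λ s → prev s ≤ c) (sym state) (proj₂ (optimal-bounds 0<c q))
    advance≡ : advance (best (n ∸ suc q)) q (placement a d b) ≡ optimal (suc q)
    advance≡ = cong (advance (best (n ∸ suc q)) q) state
    grows : 0 < choiceBit (n ∸ suc q) q a d → placement (suc a) d b ≡ optimal (suc q)
    grows 0<bit with extends (best (n ∸ suc q)) q a d | advance≡
    ... | true | eq = eq
    opens : choiceBit (n ∸ suc q) q a d ≤ 0 → placement 1 a (suc b) ≡ optimal (suc q)
    opens bit≤0 with extends (best (n ∸ suc q)) q a d | advance≡
    ... | false | eq = eq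
    addr : 2 + vert q < S
    addr = <-≤-trans (s≤s (s≤s (vert<n q<n))) n+2≤S
    emit : ∀ a′ d′ b′ y t {m bst bit x} → placement a′ d′ b′ ≡ optimal (suc q) → b′ ≤ suc q →
           wp writeBucket (Placed D R (suc q)) (mk q m a′ d′ bst bit x y t b′ out D R)
    emit a′ d′ b′ y t state′ b′≤1+q =
      2 + q , refl , small (s≤s (≤-trans q<n (n≤1+n n))) ,
      vert q , at-vert q<n , small (≤-trans (<⇒≤ (vert<n q<n)) (m≤n+m n 2)) ,
      2 + vert q , refl , <S⇒≤W addr ,
      2 + vert q , b′ , refl , refl , addr , small (≤-trans (≤-trans b′≤1+q q<n) (m≤n+m n 2)) ,
      suc q , refl , small (≤-trans q<n (m≤n+m n 2)) ,
      placed state′ b′≤1+q written′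
      where
      written′ : Written (suc q) (out [ 2 + vert q ↦ b′ ])
      written′ {p} p<1+q with m≤n⇒m<n∨m≡n p<1+q
      ... | inj₂ refl = trans (update-same out (2 + vert q)) (cong idx state′)
      -- Distinct positions hold distinct vertices, so the new entry overwrites no earlier one.
      ... | inj₁ (s≤s p<q) = trans
        (update-other out λ eq → <⇒≢ p<q
          (vert-injective (<-trans p<q q<n) q<n (suc-injective (suc-injective eq))))
        (written p<q)

  record Solved (s : State 14 3) : Set where
    field
      solved : output s 0 ≡ 1
      count  : output s 1 ≡ suc (idx (optimal n))
      bucket : ∀ {p} → p < n → output s (2 + vert p) ≡ bucketOf p

  run-finish : ∀ {D R s} → Placed D R n s → Run finish s (cost finish) Solved
  run-finish (placed {b = b} {out} state b≤n written) = run-wp finish (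
    suc b , refl , small (s≤s (≤-trans b≤n (n≤1+n n))) ,
    1 , suc b , refl , refl , ≤-trans (s≤s (s≤s z≤n)) n+2≤S , small (s≤s (≤-trans b≤n (n≤1+n n))) ,
    0 , 1 , refl , refl , ≤-trans (s≤s z≤n) n+2≤S , 1≤W ,
    record { solved = refl ; count = cong (λ s → suc (idx s)) state ; bucket = written })

  run-solve : ∀ {q m a d bst bit x y t b C′ L′} →
              Run solve ⟨ n ∷ c ∷ C′ ∷ L′ ∷ q ∷ m ∷ a ∷ d ∷ bst ∷ bit ∷ x ∷ y ∷ t ∷ b ∷ [] ,
                          zeros ∷ zeros ∷ zeros ∷ [] ⟩ (timeSolve n c) Solved
  run-solve = run-step (
    C , refl , C≤W , L , refl , ≤-trans L≤S space≤W , 0 , refl , z≤n ,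
    run-then (run-for RecentRows (timeRecentRow L) n
               (λ { (recentRows _) → refl , refl }) run-recentRow (recentRows λ _ ()))
    λ { (recentRows {D = D} recents) → run-step (
    0 , refl , z≤n ,
    run-then (run-for (BestRows D) (timeBestRow C) n
               (λ { (bestRows _) → refl , refl }) (run-bestRow (recent-table recents))
               (bestRows zero-row))
    λ { (bestRows {R = R} bests) → run-step (
    0 , refl , z≤n , 0 , refl , z≤n , 0 , refl , z≤n , 0 , refl , z≤n ,
    run-then (run-for (Placed D R) (cost place) n
               (λ { (placed _ _ _) → refl , refl })
               (run-place (recent-table recents)
                 (λ {m} m≤n → best-row m bests (*-monoˡ-≤ C (*-monoˡ-≤ C (s≤s m≤n)))))
               (placed refl z≤n λ ()))
    run-finish) }) })
    where
    -- Layer 0 is never written: an address below C * C has layer index 0, and `best 0` vanishes, as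
    -- does the initial array.
    zero-row : AgreesBelow (1 * C * C) zeros (cube best C)
    zero-row p p< rewrite m<n⇒m/n≡0 (m<n*o⇒m/o<n {n = C} {o = C} (subst (p <_) (cong (_* C) (*-identityˡ C)) p<)) = refl

-- Finite sums, and sums over unordered pairs

private
  module Sum = Algebra.Properties.CommutativeMonoid.Sum +-0-commutativeMonoid

∑ : ∀ {n} → (Fin n → ℕ) → ℕ
∑ = Sum.sum

-- An intermediate form: `edges` is built from lists, whereas invariance under permutations is
-- available for sums over `Fin`.
∑∈ : ∀ {A : Set} → List A → (A → ℕ) → ℕ
∑∈ []       f = 0
∑∈ (x ∷ xs) f = f x + ∑∈ xs f

length-filter-∑ : ∀ {A : Set} {P : Pred A 0ℓ} (P? : Decidable P) xs →
                  length (filter P? xs) ≡ ∑∈ xs (λ x → [ P? x ]· 1)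
length-filter-∑ P? []       = refl
length-filter-∑ P? (x ∷ xs) with P? x
... | yes _ = cong suc (length-filter-∑ P? xs)
... | no _  = length-filter-∑ P? xs

∑∈-filter : ∀ {A : Set} {P : Pred A 0ℓ} (P? : Decidable P) xs f →
            ∑∈ (filter P? xs) f ≡ ∑∈ xs (λ x → [ P? x ]· f x)
∑∈-filter P? []       f = refl
∑∈-filter P? (x ∷ xs) f with P? x
... | yes _ = cong (f x +_) (∑∈-filter P? xs f)
... | no _  = ∑∈-filter P? xs f

length-filter-∁ : ∀ {A : Set} {P : Pred A 0ℓ} (P? : Decidable P) xs →
                  length (filter P? xs) + length (filter (∁? P?) xs) ≡ length xs
length-filter-∁ P? []       = refl
length-filter-∁ P? (x ∷ xs) with P? x
... | yes _ = cong suc (length-filter-∁ P? xs)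
... | no _  = trans (+-suc _ _) (cong suc (length-filter-∁ P? xs))

∑∈-++ : ∀ {A : Set} (xs ys : List A) f → ∑∈ (xs ++ ys) f ≡ ∑∈ xs f + ∑∈ ys f
∑∈-++ []       ys f = refl
∑∈-++ (x ∷ xs) ys f = trans (cong (f x +_) (∑∈-++ xs ys f)) (sym (+-assoc (f x) _ _))

∑∈-map : ∀ {A B : Set} (g : A → B) xs f → ∑∈ (List.map g xs) f ≡ ∑∈ xs (f ∘ g)
∑∈-map g []       f = refl
∑∈-map g (x ∷ xs) f = cong (f (g x) +_) (∑∈-map g xs f)

∑∈-tabulate : ∀ {A : Set} {n} (g : Fin n → A) f → ∑∈ (tabulate g) f ≡ ∑ (f ∘ g)
∑∈-tabulate {n = zero}  g f = refl
∑∈-tabulate {n = suc n} g f = cong (f (g Fin.zero) +_) (∑∈-tabulate (g ∘ Fin.suc) f)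

∑∈-cartesianProduct : ∀ {A B : Set} (xs : List A) (ys : List B) f →
  ∑∈ (cartesianProduct xs ys) f ≡ ∑∈ xs (λ x → ∑∈ ys (λ y → f (x , y)))
∑∈-cartesianProduct []       ys f = refl
∑∈-cartesianProduct (x ∷ xs) ys f =
  trans (∑∈-++ (List.map (x ,_) ys) _ f)
        (cong₂ _+_ (∑∈-map (x ,_) ys f) (∑∈-cartesianProduct xs ys f))

∑-cong : ∀ {n} {f g : Fin n → ℕ} → (∀ i → f i ≡ g i) → ∑ f ≡ ∑ g
∑-cong = Sum.sum-cong-≗

∑-toℕ : ∀ n f → ∑ {n} (f ∘ toℕ) ≡ ∑< n f
∑-toℕ zero    f = refl
∑-toℕ (suc n) f = trans (cong (f 0 +_) (∑-toℕ n (f ∘ suc))) (sym (∑<-head n f))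

∑<-restrict : ∀ {q} n f → q ≤ n → ∑< n (λ p → [ p <? q ]· f p) ≡ ∑< q f
∑<-restrict zero    f z≤n = refl
∑<-restrict {q} (suc n) f q≤n with m≤n⇒m<n∨m≡n q≤n
... | inj₁ (s≤s q≤n) = trans (cong₂ _+_ (∑<-restrict n f q≤n) (·-false (n <? q) (≤⇒≯ q≤n))) (+-identityʳ _)
... | inj₂ refl      = ∑<-cong q λ p p<q → ·-true (p <? q) p<q

module _ {n : ℕ} where

  Symmetric₀ : (Fin n → Fin n → ℕ) → Set
  Symmetric₀ g = (∀ u v → g u v ≡ g v u) × (∀ u → g u u ≡ 0)

  ∑pairs : (Fin n → Fin n → ℕ) → ℕ
  ∑pairs g = ∑ λ u → ∑ λ v → [ u Fin.<? v ]· g u v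

  ∑pairs-double : ∀ {g} → Symmetric₀ g → ∑ (λ u → ∑ (g u)) ≡ ∑pairs g + ∑pairs g
  ∑pairs-double {g} (symmetric , diagonal) = begin
    ∑ (λ u → ∑ (g u))
      ≡⟨ ∑-cong (λ u → trans (∑-cong (split u)) (Sum.∑-distrib-+ (λ v → [ u Fin.<? v ]· g u v) _)) ⟩
    ∑ (λ u → ∑ (λ v → [ u Fin.<? v ]· g u v) + ∑ (λ v → [ v Fin.<? u ]· g v u))
      ≡⟨ Sum.∑-distrib-+ (λ u → ∑ (λ v → [ u Fin.<? v ]· g u v)) _ ⟩
    ∑pairs g + ∑ (λ u → ∑ (λ v → [ v Fin.<? u ]· g v u))
      ≡⟨ cong (∑pairs g +_) (Sum.∑-comm (λ u v → [ v Fin.<? u ]· g v u)) ⟩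
    ∑pairs g + ∑pairs g ∎
    where
    open ≡-Reasoning
    split : ∀ u v → g u v ≡ [ u Fin.<? v ]· g u v + [ v Fin.<? u ]· g v u
    split u v with Fin.<-cmp u v
    ... | tri< u<v _ v≮u = sym (trans (cong₂ _+_ (·-true (u Fin.<? v) u<v) (·-false (v Fin.<? u) v≮u)) (+-identityʳ _))
    ... | tri≈ u≮v refl v≮u = trans (diagonal u) (sym (cong₂ _+_ (·-false (u Fin.<? v) u≮v) (·-false (v Fin.<? u) v≮u)))
    ... | tri> u≮v _ v<u = sym (trans (cong₂ _+_ (·-false (u Fin.<? v) u≮v) (·-true (v Fin.<? u) v<u)) (symmetric v u))

  -- σ does not respect u < v, so the sum is doubled to one over all ordered pairs, which a
  -- permutation merely reindexes, and then halved.
  ∑pairs-permute : ∀ {g} → Symmetric₀ g → (σ : Permutation′ n) →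
                   ∑pairs g ≡ ∑pairs (λ i j → g (σ ⟨$⟩ʳ i) (σ ⟨$⟩ʳ j))
  ∑pairs-permute {g} sym₀@(symmetric , diagonal) σ = halve (begin
    ∑pairs g + ∑pairs g              ≡⟨ sym (∑pairs-double sym₀) ⟩
    ∑ (λ u → ∑ (g u))                ≡⟨ Sum.sum-permute (λ u → ∑ (g u)) σ ⟩
    ∑ (λ i → ∑ (g (σ ⟨$⟩ʳ i)))       ≡⟨ ∑-cong (λ i → Sum.sum-permute (g (σ ⟨$⟩ʳ i)) σ) ⟩
    ∑ (λ i → ∑ (λ j → h i j))        ≡⟨ ∑pairs-double ((λ i j → symmetric _ _) , λ i → diagonal _) ⟩
    ∑pairs h + ∑pairs h              ∎)
    where
    open ≡-Reasoning
    h : Fin n → Fin n → ℕ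
    h i j = g (σ ⟨$⟩ʳ i) (σ ⟨$⟩ʳ j)
    halve : ∀ {x y} → x + x ≡ y + y → x ≡ y
    halve {x} {y} eq with <-cmp x y
    ... | tri< x<y _ _ = contradiction eq (<⇒≢ (+-mono-< x<y x<y))
    ... | tri≈ _ x≡y _ = x≡y
    ... | tri> _ _ y<x = contradiction (sym eq) (<⇒≢ (+-mono-< y<x y<x))

-- Ordered arrangements as paths

module Layout {n′ : ℕ} (G : Graph (suc n′)) (σ : Permutation′ (suc n′)) where

  open Graph G renaming (sym to adj-sym)

  n : ℕ
  n = suc n′

  -- Reduction mod n only makes the function total; it is the identity on positions.
  vertex : ℕ → Fin n
  vertex p = σ ⟨$⟩ʳ (p mod n)

  position : Fin n → ℕ
  position v = toℕ (σ ⟨$⟩ˡ v)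

  adjBit : ℕ → ℕ → ℕ
  adjBit q p = [ adj? (vertex q) (vertex p) ]· 1

  toℕ-mod : ∀ (i : Fin n) → toℕ i mod n ≡ i
  toℕ-mod i = Fin.toℕ-injective (trans (Fin.toℕ-fromℕ< _) (m<n⇒m%n≡m (Fin.toℕ<n i)))

  vertex-toℕ : ∀ i → vertex (toℕ i) ≡ σ ⟨$⟩ʳ i
  vertex-toℕ i = cong (σ ⟨$⟩ʳ_) (toℕ-mod i)

  vertex-position : ∀ v → vertex (position v) ≡ v
  vertex-position v = trans (vertex-toℕ (σ ⟨$⟩ˡ v)) (inverseʳ σ)

  position-vertex : ∀ {p} → p < n → position (vertex p) ≡ p
  position-vertex {p} p<n = trans (cong toℕ (inverseˡ σ)) (trans (Fin.toℕ-fromℕ< _) (m<n⇒m%n≡m p<n))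

  position-< : ∀ v → position v < n
  position-< v = Fin.toℕ<n _

  module _ (B : Arrangement n) where
    open Arrangement B

    bucketNo : ℕ → ℕ
    bucketNo p = toℕ (bucket (vertex p))

    bucketSize-∑ : ∀ i → bucketSize B i ≡ ∑< n (λ p → [ bucketNo p ≟ toℕ i ]· 1)
    bucketSize-∑ i = begin
      bucketSize B i                                      ≡⟨ length-filter-∑ (λ v → bucket v Fin.≟ i) (allFin n) ⟩
      ∑∈ (allFin n) (λ v → [ bucket v Fin.≟ i ]· 1)       ≡⟨ ∑∈-tabulate id (λ v → [ bucket v Fin.≟ i ]· 1) ⟩
      ∑ (λ v → [ bucket v Fin.≟ i ]· 1)                   ≡⟨ Sum.sum-permute (λ v → [ bucket v Fin.≟ i ]· 1) σ ⟩
      ∑ (λ p → [ bucket (σ ⟨$⟩ʳ p) Fin.≟ i ]· 1)          ≡⟨ ∑-cong (λ p → ·-cong (bucket (σ ⟨$⟩ʳ p) Fin.≟ i) (bucketNo (toℕ p) ≟ toℕ i) {1}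
                                                                (λ eq → cong toℕ (trans (cong bucket (vertex-toℕ p)) eq))
                                                                (λ eq → trans (cong bucket (sym (vertex-toℕ p))) (Fin.toℕ-injective eq))
                                                                (λ _ → refl)) ⟩
      ∑ (λ p → [ bucketNo (toℕ {n} p) ≟ toℕ i ]· 1)       ≡⟨ ∑-toℕ n (λ p → [ bucketNo p ≟ toℕ i ]· 1) ⟩
      ∑< n (λ p → [ bucketNo p ≟ toℕ i ]· 1)              ∎
      where open ≡-Reasoning

    width-bound : ∀ {c} → (∀ i → bucketSize B i ≤ c) → width B ≤ c
    width-bound size≤ = f[argmax]≤v⁺ {f = id} z≤n (All.map⁺ (All.tabulate⁺ {f = id} size≤))

    bucketSize≤width : ∀ i → bucketSize B i ≤ width B
    bucketSize≤width i = All.lookup (f[xs]≤f[argmax] {f = id} 0 (List.map (bucketSize B) (allFin k)))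
                                    (∈-map⁺ (bucketSize B) (∈-allFin i))

    #short : ℕ
    #short = length (filter (short? B) (edges G))

    #short+#long : #short + #long B G ≡ length (edges G)
    #short+#long = length-filter-∁ (short? B) (edges G)

    shortAt : ℕ → ℕ → ℕ
    shortAt q p = [ short? B (vertex p , vertex q) ]· adjBit q p

    -- Each edge is charged to its later endpoint in σ. Shortness and adjacency are symmetric, so
    -- the pairs may be permuted by σ; exchanging the sums then groups them by later endpoint.
    #short-∑ : #short ≡ ∑< n (λ q → ∑< q (shortAt q))
    #short-∑ = begin
      #short
        ≡⟨ length-filter-∑ (short? B) (edges G) ⟩
      ∑∈ (edges G) (λ e → [ short? B e ]· 1)
        ≡⟨ ∑∈-filter edge? (cartesianProduct (allFin n) (allFin n)) (λ e → [ short? B e ]· 1) ⟩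
      ∑∈ (cartesianProduct (allFin n) (allFin n)) (λ e → [ edge? e ]· [ short? B e ]· 1)
        ≡⟨ ∑∈-cartesianProduct (allFin n) (allFin n) (λ e → [ edge? e ]· [ short? B e ]· 1) ⟩
      ∑∈ (allFin n) (λ u → ∑∈ (allFin n) (λ v → [ edge? (u , v) ]· [ short? B (u , v) ]· 1))
        ≡⟨ ∑∈-tabulate {n = n} id (λ u → ∑∈ (allFin n) (λ v → [ edge? (u , v) ]· [ short? B (u , v) ]· 1)) ⟩
      ∑ (λ u → ∑∈ (allFin n) (λ v → [ edge? (u , v) ]· [ short? B (u , v) ]· 1))
        ≡⟨ ∑-cong (λ u → trans (∑∈-tabulate {n = n} id (λ v → [ edge? (u , v) ]· [ short? B (u , v) ]· 1)) (∑-cong (λ v → regroup (u Fin.<? v) (adj? u v) (short? B (u , v))))) ⟩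
      ∑pairs g
        ≡⟨ ∑pairs-permute (g-sym , g-diag) σ ⟩
      ∑pairs (λ i j → g (σ ⟨$⟩ʳ i) (σ ⟨$⟩ʳ j))
        ≡⟨ Sum.∑-comm (λ i j → [ i Fin.<? j ]· g (σ ⟨$⟩ʳ i) (σ ⟨$⟩ʳ j)) ⟩
      ∑ (λ j → ∑ (λ i → [ i Fin.<? j ]· g (σ ⟨$⟩ʳ i) (σ ⟨$⟩ʳ j)))
        ≡⟨ ∑-cong (λ j → trans (∑-cong (λ i → cong ([ i Fin.<? j ]·_) (g≡shortAt i j)))
                         (trans (∑-toℕ n (λ p → [ p <? toℕ j ]· shortAt (toℕ j) p))
                                (∑<-restrict n (shortAt (toℕ j)) (<⇒≤ (Fin.toℕ<n j))))) ⟩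
      ∑ (λ j → ∑< (toℕ {n} j) (shortAt (toℕ j)))
        ≡⟨ ∑-toℕ n (λ q → ∑< q (shortAt q)) ⟩
      ∑< n (λ q → ∑< q (shortAt q)) ∎
      where
      open ≡-Reasoning
      edge? : ∀ (e : Fin n × Fin n) → Dec (proj₁ e Fin.< proj₂ e × Adj (proj₁ e) (proj₂ e))
      edge? (u , v) = (u Fin.<? v) ×-dec adj? u v
      -- Adjacency is queried in the row of the later vertex, the row from which the program reads.
      g : Fin n → Fin n → ℕ
      g u v = [ short? B (u , v) ]· [ adj? v u ]· 1
      regroup : ∀ {u v} → (l? : Dec (u Fin.< v)) (a? : Dec (Adj u v)) (s? : Dec (Short B (u , v))) →
                [ l? ×-dec a? ]· [ s? ]· 1 ≡ [ l? ]· [ s? ]· [ adj? v u ]· 1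
      regroup (no _)  a? s? = refl
      regroup (yes _) (yes a) (yes _) = sym (·-true (adj? _ _) (adj-sym a))
      regroup (yes _) (yes a) (no _)  = refl
      regroup (yes _) (no ¬a) (yes _) = sym (·-false (adj? _ _) (¬a ∘ adj-sym))
      regroup (yes _) (no ¬a) (no _)  = refl
      short-sym : ∀ {u v} → Short B (u , v) → Short B (v , u)
      short-sym {u} {v} = subst (_< 2) (∣-∣-comm (toℕ (bucket u)) (toℕ (bucket v)))
      g-sym : ∀ u v → g u v ≡ g v u
      g-sym u v = ·-cong (short? B (u , v)) (short? B (v , u)) (short-sym {u} {v}) (short-sym {v} {u})
        λ _ → ·-cong (adj? v u) (adj? u v) adj-sym adj-sym λ _ → refl
      g-diag : ∀ u → g u u ≡ 0
      g-diag u = trans (·-cong (short? B (u , u)) (short? B (u , u)) id id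
                          λ _ → ·-false (adj? u u) (irrefl refl)) (zero· (short? B (u , u)))
        where
        zero· : ∀ {P : Set} (P? : Dec P) → [ P? ]· 0 ≡ 0
        zero· (yes _) = refl
        zero· (no _)  = refl
      g≡shortAt : ∀ i j → g (σ ⟨$⟩ʳ i) (σ ⟨$⟩ʳ j) ≡ shortAt (toℕ j) (toℕ i)
      g≡shortAt i j = cong₂ g (sym (vertex-toℕ i)) (sym (vertex-toℕ j))

  module _ (c : ℕ) where

    open Recurrence n c adjBit

    bucketNo-mono : ∀ B → Ordered B σ → ∀ {p q} → p ≤ q → q < n → bucketNo B p ≤ bucketNo B q
    bucketNo-mono B ordered {p} {q} p≤q q<n with m≤n⇒m<n∨m≡n p≤q
    ... | inj₂ refl = ≤-refl
    ... | inj₁ p<q  = ordered (subst₂ _<_ (sym (toℕ-mod-small (<-trans p<q q<n))) (sym (toℕ-mod-small q<n)) p<q)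
      where
      toℕ-mod-small : ∀ {p} → p < n → toℕ (p mod n) ≡ p
      toℕ-mod-small p<n = trans (Fin.toℕ-fromℕ< _) (m<n⇒m%n≡m p<n)

    -- Bucket numbers are monotone, so a pair p < q is short exactly when the bucket of q is at most
    -- one above that of p. `recent-window` at time q + 1 turns this into a window; since that
    -- window contains q itself, its width drops by one.
    #short-gain : ∀ B {st} (path : Path n st) →
                  (∀ q → q < n → bucketNo B q ≡ bucketAt path q) →
                  #short B ≡ ∑< n (gain st)
    #short-gain B {st} path agree = trans (#short-∑ B) (∑<-cong n λ q q<n →
      ∑<-window q (pred (width′ q)) (adjBit q) (λ p → short? B (vertex p , vertex q))
        (λ p p<q short → to p<q (proj₁ (recent-window path (suc q) q<n p (m<n⇒m<1+n p<q))
          (subst₂ (λ x y → y ≤ suc x) (agree p (<-trans p<q q<n)) (agree q q<n) (near short))))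
        (λ p p<q q≤ → far (mono q<n p<q)
          (subst₂ (λ x y → y ≤ suc x) (sym (agree p (<-trans p<q q<n))) (sym (agree q q<n))
            (proj₂ (recent-window path (suc q) q<n p (m<n⇒m<1+n p<q)) (from p<q q≤)))))
      where
      width′ : ℕ → ℕ
      width′ q = cur (st (suc q)) + prev (st (suc q))
      to : ∀ {p q w} → p < q → suc q ≤ p + w → q ≤ p + pred w
      to {p} {q} {zero}  p<q h = <⇒≤ h
      to {p} {q} {suc w} p<q h = s≤s⁻¹ (subst (suc q ≤_) (+-suc p w) h)
      from : ∀ {p q w} → p < q → q ≤ p + pred w → suc q ≤ p + w
      from {p} {q} {zero}  p<q h = contradiction (subst (q ≤_) (+-identityʳ p) h) (<⇒≱ p<q)
      from {p} {q} {suc w} p<q h = subst (suc q ≤_) (sym (+-suc p w)) (s≤s h)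
      mono : ∀ {p q} → q < n → p < q → bucketNo B p ≤ bucketNo B q
      mono {p} {q} q<n p<q = subst₂ _≤_ (sym (agree p (<-trans p<q q<n))) (sym (agree q q<n))
                                    (bucketAt-mono path q<n (<⇒≤ p<q))
      near : ∀ {x y} → ∣ x - y ∣ < 2 → y ≤ suc x
      near {x} {y} h = ≤-trans (m≤n+∣n-m∣ y x) (≤-trans (+-monoʳ-≤ x (s≤s⁻¹ h)) (≤-reflexive (+-comm x 1)))
      far : ∀ {x y} → x ≤ y → y ≤ suc x → ∣ x - y ∣ < 2
      far {x} {y} x≤y y≤1+x = s≤s (≤-trans (≤-reflexive (m≤n⇒∣m-n∣≡n∸m x≤y))
        (≤-trans (∸-monoˡ-≤ x y≤1+x) (≤-reflexive (m+n∸n≡m 1 x))))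

    module _ (B : Arrangement n) (ordered : Ordered B σ) where
      open Arrangement B

      private
        β = bucketNo B

      β-onto : ∀ (j : Fin k) → ∃[ p ] (p < n × β p ≡ toℕ j)
      β-onto j with v , bucket≡j ← nonempty j =
        position v , position-< v , cong toℕ (trans (cong bucket (vertex-position v)) bucket≡j)

      β-zero : β 0 ≡ 0
      β-zero with p , p<n , βp≡ ← β-onto (fromℕ< (≤-<-trans z≤n (Fin.toℕ<n (bucket (vertex 0))))) =
        n≤0⇒n≡0 (≤-trans (bucketNo-mono B ordered z≤n p<n) (≤-reflexive (trans βp≡ (Fin.toℕ-fromℕ< _))))

      -- Here nonemptiness of buckets is decisive: a skipped bucket would hold some position p, and
      -- monotonicity fails both for p ≤ q and for p > q.
      β-step : ∀ q → suc q < n → β (suc q) ≤ suc (β q)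
      β-step q 1+q<n with β (suc q) ≤? suc (β q)
      ... | yes small = small
      ... | no  large
        with p , p<n , βp≡ ← β-onto (fromℕ< (<-trans (≰⇒> large) (Fin.toℕ<n (bucket (vertex (suc q))))))
        with βp≡′ ← trans βp≡ (Fin.toℕ-fromℕ< _) | p ≤? q
      ...   | yes p≤q = contradiction (subst (_≤ β q) βp≡′ (bucketNo-mono B ordered p≤q (<-trans (n<1+n q) 1+q<n))) (<⇒≱ (n<1+n _))
      ...   | no  p≰q = contradiction (subst (β (suc q) ≤_) βp≡′ (bucketNo-mono B ordered (≰⇒> p≰q) p<n)) large

      -- Rereads a given arrangement as a path, which brings every competitor under `gain-bound`.
      follow : ℕ → Placement
      follow zero    = placement 0 0 0
      follow (suc q) with β q ≤? idx (follow q)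
      ... | yes _ = grow (follow q)
      ... | no _  = fresh (follow q)

      follow-idx : ∀ q → q < n → idx (follow (suc q)) ≡ β q
      follow-idx zero q<n with β 0 ≤? 0
      ... | yes β≤0 = sym β-zero
      ... | no β≰0 = contradiction (≤-reflexive β-zero) β≰0
      follow-idx (suc q) q<n with β (suc q) ≤? idx (follow (suc q)) | follow-idx q (<⇒≤ q<n)
      ... | yes le | eq = ≤-antisym (≤-trans (≤-reflexive eq) (bucketNo-mono B ordered (n≤1+n q) q<n)) le
      ... | no gt  | eq = ≤-antisym (≰⇒> gt) (≤-trans (β-step q q<n) (s≤s (≤-reflexive (sym eq))))

      follow-path : Path n follow
      follow-path = record { start = refl ; first = first ; step = step }
        where
        first : follow 1 ≡ placement 1 0 0
        first with β 0 ≤? 0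
        ... | yes _  = refl
        ... | no β≰0 = contradiction (≤-reflexive β-zero) β≰0
        step : ∀ q → q < n → follow (suc q) ≡ grow (follow q) ⊎ follow (suc q) ≡ fresh (follow q)
        step q _ with β q ≤? idx (follow q)
        ... | yes _ = inj₁ refl
        ... | no _  = inj₂ refl

      -- `cur` counts the members of the bucket up to q only, hence at most the whole bucket.
      follow-cur : ∀ q → q < n → cur (follow (suc q)) ≤ width B
      follow-cur q q<n = begin
        cur (follow (suc q))
          ≡⟨ sym (current-count follow-path q q<n) ⟩
        ∑< (suc q) (λ p → [ bucketAt follow-path p ≟ bucketAt follow-path q ]· 1)
          ≡⟨ ∑<-cong (suc q) (λ p p<1+q → cong₂ (λ x y → [ x ≟ y ]· 1)
               (follow-idx p (<-≤-trans p<1+q q<n)) (follow-idx q q<n)) ⟩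
        ∑< (suc q) (λ p → [ β p ≟ β q ]· 1)
          ≤⟨ ∑<-monoˡ _ q<n ⟩
        ∑< n (λ p → [ β p ≟ β q ]· 1)
          ≡⟨ sym (bucketSize-∑ B (bucket (vertex q))) ⟩
        bucketSize B (bucket (vertex q))
          ≤⟨ bucketSize≤width B (bucket (vertex q)) ⟩
        width B ∎
        where open ≤-Reasoning

      #short-bound : width B ≤ c → #short B ≤ best n 0 0
      #short-bound width≤c = ≤-trans
        (≤-reflexive (#short-gain B follow-path λ q q<n → sym (follow-idx q q<n)))
        (gain-bound follow-path λ q q<n → ≤-trans (follow-cur q q<n) width≤c)

      -- Settles c = 0 with a vertex present: nothing is feasible.
      width-positive : 1 ≤ width B
      width-positive = ≤-trans
        (≤-reflexive (sym (trans (sym (current-count follow-path 0 z<s))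
          (·-true (bucketAt follow-path 0 ≟ bucketAt follow-path 0) refl))))
        (follow-cur 0 z<s)

    module Best (0<c : 0 < c) where

      path : Path n optimal
      path = optimal-path 0<c

      k : ℕ
      k = suc (idx (optimal n))

      place< : ∀ v → bucketAt path (position v) < k
      place< v = s≤s (bucketAt-≤-idx path n ≤-refl (position-< v))

      arrangement : Arrangement n
      arrangement = record
        { k        = k
        ; bucket   = λ v → fromℕ< (place< v)
        ; nonempty = nonempty
        }
        where
        nonempty : ∀ (j : Fin k) → ∃[ v ] fromℕ< (place< v) ≡ j
        -- Position n′ is the last one and lies in bucket k - 1 by definition, so the positions up
        -- to it reach every j.
        nonempty j with p , p≤n′ , eq ← bucketAt-onto path n′ ≤-refl (s≤s⁻¹ (Fin.toℕ<n j)) =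
          vertex p , Fin.toℕ-injective (trans (Fin.toℕ-fromℕ< _)
            (trans (cong (bucketAt path) (position-vertex (s≤s p≤n′))) eq))

      arrangement-bucketNo : ∀ q → q < n → bucketNo arrangement q ≡ bucketAt path q
      arrangement-bucketNo q q<n = trans (Fin.toℕ-fromℕ< _) (cong (bucketAt path) (position-vertex q<n))

      arrangement-ordered : Ordered arrangement σ
      arrangement-ordered {i} {j} i<j = subst₂ _≤_ (eq i) (eq j) (bucketAt-mono path (Fin.toℕ<n j) (<⇒≤ i<j))
        where
        eq : ∀ i → bucketAt path (toℕ i) ≡ toℕ (Arrangement.bucket arrangement (σ ⟨$⟩ʳ i))
        eq i = trans (sym (arrangement-bucketNo (toℕ i) (Fin.toℕ<n i)))
                     (cong (toℕ ∘ Arrangement.bucket arrangement) (vertex-toℕ i))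

      arrangement-width : width arrangement ≤ c
      arrangement-width = width-bound arrangement λ i → begin
        bucketSize arrangement i
          ≡⟨ bucketSize-∑ arrangement i ⟩
        ∑< n (λ p → [ bucketNo arrangement p ≟ toℕ i ]· 1)
          ≡⟨ ∑<-cong n (λ p p<n → cong (λ x → [ x ≟ toℕ i ]· 1) (arrangement-bucketNo p p<n)) ⟩
        ∑< n (λ p → [ bucketAt path p ≟ toℕ i ]· 1)
          ≤⟨ bucket-count-bound path (λ q _ → proj₁ (optimal-bounds 0<c (suc q))) (toℕ i) n ≤-refl ⟩
        c ∎
        where open ≤-Reasoning

      arrangement-optimal : ∀ B → Ordered B σ → width B ≤ c → #long arrangement G ≤ #long B G
      arrangement-optimal B ordered width≤c = +-cancelˡ-≤ (#short arrangement) _ _ (begin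
        #short arrangement + #long arrangement G  ≡⟨ #short+#long arrangement ⟩
        length (edges G)                          ≡⟨ sym (#short+#long B) ⟩
        #short B + #long B G                      ≤⟨ +-monoˡ-≤ (#long B G) (#short-bound B ordered width≤c) ⟩
        best n 0 0 + #long B G                    ≡⟨ cong (_+ #long B G) (sym optimal-gain) ⟩
        ∑< n (gain optimal) + #long B G           ≡⟨ cong (_+ #long B G) (sym (#short-gain arrangement path arrangement-bucketNo)) ⟩
        #short arrangement + #long B G            ∎)
        where open ≤-Reasoning

-- Addresses in the encoded input

at-∷ : ∀ {x xs p v} → At xs p v → At (x ∷ xs) (suc p) v
at-∷ (found i p≡i eq) = found (Fin.suc i) (cong suc p≡i) eq

at-++ˡ : ∀ {xs ys p v} → At xs p v → At (xs ++ ys) p v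
at-++ˡ {x ∷ xs} (found Fin.zero p≡i eq)     = found Fin.zero p≡i eq
at-++ˡ {x ∷ xs} (found (Fin.suc i) refl eq) = at-∷ (at-++ˡ {xs} (found i refl eq))

at-++ʳ : ∀ xs {ys p v} → At ys p v → At (xs ++ ys) (length xs + p) v
at-++ʳ []       at = at
at-++ʳ (x ∷ xs) at = at-∷ (at-++ʳ xs at)

at-tabulate : ∀ {n} (f : Fin n → ℕ) i → At (tabulate f) (toℕ i) (f i)
at-tabulate f Fin.zero    = found Fin.zero refl refl
at-tabulate f (Fin.suc i) = at-∷ (at-tabulate (f ∘ Fin.suc) i)

at-map-allFin : ∀ {n} (f : Fin n → ℕ) i → At (List.map f (allFin n)) (toℕ i) (f i)
at-map-allFin f i rewrite map-tabulate id f = at-tabulate f i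

module _ {A : Set} {w : ℕ} (f : A → List ℕ) (length≡ : ∀ x → length (f x) ≡ w) where

  at-concatMap : ∀ {m} (g : Fin m → A) i {p v} → At (f (g i)) p v →
                 At (concatMap f (tabulate g)) (toℕ i * w + p) v
  at-concatMap g Fin.zero    at = at-++ˡ at
  at-concatMap g (Fin.suc i) {p} {v} at =
    subst (λ q → At (concatMap f (tabulate g)) q v)
          (trans (cong (_+ (toℕ i * w + p)) (length≡ (g Fin.zero))) (sym (+-assoc w (toℕ i * w) p)))
          (at-++ʳ (f (g Fin.zero)) (at-concatMap (g ∘ Fin.suc) i at))

  length-concatMap : ∀ {m} (g : Fin m → A) → length (concatMap f (tabulate g)) ≡ m * w
  length-concatMap {zero}  g = refl
  length-concatMap {suc m} g = trans (length-++ (f (g Fin.zero)))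
    (cong₂ _+_ (length≡ (g Fin.zero)) (length-concatMap (g ∘ Fin.suc)))

length-map-allFin : ∀ n (f : Fin n → ℕ) → length (List.map f (allFin n)) ≡ n
length-map-allFin n f = trans (length-map f (allFin n)) (length-tabulate id)

at-≤-max : ∀ In {p v} → At In p v → v ≤ max 0 In
at-≤-max In (found i _ refl) = All.lookup (f[xs]≤f[argmax] {f = id} 0 In) (∈-lookup i)

-- Linear bounds for nested loops

-- The final test and the N tests before rounds are at most N * M each, which accounts for the 2.
loop-bound : ∀ N {T M} k → 1 ≤ N → 1 ≤ M → T ≤ k * M → suc (N * suc T) ≤ (2 + k) * (N * M)
loop-bound N {T} {M} k 1≤N 1≤M T≤ = begin
  1 + N * suc T                       ≡⟨ cong (1 +_) (*-suc N T) ⟩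
  1 + (N + N * T)                     ≤⟨ +-mono-≤ (*-mono-≤ 1≤N 1≤M) (+-mono-≤
                                           (≤-trans (≤-reflexive (sym (*-identityʳ N))) (*-monoʳ-≤ N 1≤M))
                                           (≤-trans (*-monoʳ-≤ N T≤) (≤-reflexive swap))) ⟩
  N * M + (N * M + k * (N * M))       ∎
  where
  open ≤-Reasoning
  swap : N * (k * M) ≡ k * (N * M)
  swap = trans (sym (*-assoc N k M)) (trans (cong (_* M) (*-comm N k)) (*-assoc k N M))

const-bound : ∀ k {M} → 1 ≤ M → k ≤ k * M
const-bound k {M} 1≤M = m≤m*n k M {{>-nonZero 1≤M}}

plus-bound : ∀ k l M {T U} → T ≤ k * M → U ≤ l * M → T + U ≤ (k + l) * M
plus-bound k l M T≤ U≤ = ≤-trans (+-mono-≤ T≤ U≤) (≤-reflexive (sym (*-distribʳ-+ M k l)))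

rescale : ∀ k l m {j n} → j ≤ k * n → n ≤ l * m → j ≤ k * l * m
rescale k l m j≤ n≤ = ≤-trans j≤ (≤-trans (*-monoʳ-≤ k n≤) (≤-reflexive (sym (*-assoc k l m))))

nested-bound : ∀ a N T M k → 1 ≤ N → 1 ≤ M → T ≤ k * M →
               a + (suc (N * suc T) + 1) ≤ (a + (2 + k + 1)) * (N * M)
nested-bound a N T M k 1≤N 1≤M T≤ =
  plus-bound a (2 + k + 1) (N * M) (const-bound a 1≤N*M)
    (plus-bound (2 + k) 1 (N * M) (loop-bound N k 1≤N 1≤M T≤) (const-bound 1 1≤N*M))
  where
  1≤N*M : 1 ≤ N * M
  1≤N*M = *-mono-≤ 1≤N 1≤M

innermost-bound : ∀ a N T → 1 ≤ N → a + (suc (N * suc T) + 1) ≤ (a + (2 + T + 1)) * N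
innermost-bound a N T 1≤N = subst (λ x → a + (suc (N * suc T) + 1) ≤ (a + (2 + T + 1)) * x) (*-identityʳ N)
  (nested-bound a N T 1 T 1≤N ≤-refl (const-bound T ≤-refl))

three-loops-bound : ∀ k₁ k₂ k₃ M {T₁ T₂ T₃} → 1 ≤ M → T₁ ≤ k₁ * M → T₂ ≤ k₂ * M → T₃ ≤ k₃ * M →
  3 + (T₁ + (1 + (T₂ + (4 + (T₃ + 3))))) ≤ (3 + (k₁ + (1 + (k₂ + (4 + (k₃ + 3)))))) * M
three-loops-bound k₁ k₂ k₃ M 1≤M T₁≤ T₂≤ T₃≤ =
  plus-bound 3 (k₁ + r₁) M (const-bound 3 1≤M) (plus-bound k₁ r₁ M T₁≤
  (plus-bound 1 (k₂ + r₂) M (const-bound 1 1≤M) (plus-bound k₂ r₂ M T₂≤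
  (plus-bound 4 (k₃ + 3) M (const-bound 4 1≤M) (plus-bound k₃ 3 M T₃≤ (const-bound 3 1≤M))))))
  where
  r₁ r₂ : ℕ
  r₂ = 4 + (k₃ + 3)
  r₁ = 1 + (k₂ + r₂)

-- These mirror the running times, with each loop replaced by the factor from `loop-bound`. Their
-- values are 21, 36, 42 and 116, so 4 * `solveK` is 464.
recentRowK bestColumnK bestRowK solveK : ℕ
recentRowK  = cost recentRowStart + (2 + cost recentCell + 1)
bestColumnK = 1 + (2 + cost bestCell + 1)
bestRowK    = 3 + (2 + bestColumnK + 1)
solveK      = 3 + (2 + recentRowK + (1 + (2 + bestRowK + (4 + (2 + cost place + 3)))))

module _ (c : ℕ) where

  private
    C L : ℕ
    C = suc c
    L = suc (c + c)

  timeRecentRow-bound : timeRecentRow L ≤ recentRowK * L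
  timeRecentRow-bound = innermost-bound (cost recentRowStart) L (cost recentCell) (s≤s z≤n)

  timeBestColumn-bound : timeBestColumn C ≤ bestColumnK * C
  timeBestColumn-bound = innermost-bound 1 C (cost bestCell) (s≤s z≤n)

  timeBestRow-bound : timeBestRow C ≤ bestRowK * (C * C)
  timeBestRow-bound =
    nested-bound 3 C (timeBestColumn C) C bestColumnK (s≤s z≤n) (s≤s z≤n) timeBestColumn-bound

  timeSolve-bound : ∀ n → 1 ≤ n → timeSolve n c ≤ solveK * (n * (C * C))
  timeSolve-bound n 1≤n =
    three-loops-bound (2 + recentRowK) (2 + bestRowK) (2 + cost place) (n * (C * C))
      (*-mono-≤ 1≤n (s≤s z≤n))
      (≤-trans (loop-bound n recentRowK 1≤n (s≤s z≤n) timeRecentRow-bound)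
               (*-monoʳ-≤ (2 + recentRowK) (*-monoʳ-≤ n L≤C*C)))
      (loop-bound n bestRowK 1≤n (s≤s z≤n) timeBestRow-bound)
      (loop-bound n (cost place) 1≤n (s≤s z≤n) (const-bound (cost place) (s≤s z≤n)))
    where
    L≤C*C : L ≤ C * C
    L≤C*C = s≤s (+-monoʳ-≤ c (m≤m*n c C))

-- The global constant and the word bound

-- Any K ≥ 4 * solveK works. It is abstract because unfolding a power with
-- exponent K is infeasible.
abstract
  K : ℕ
  K = 500

  ≤K : ∀ m → T (m ≤ᵇ 500) → m ≤ K
  ≤K m = ≤ᵇ⇒≤ m 500

≤-cube : ∀ {x} → 1 ≤ x → x ≤ x * x * x
≤-cube {x} 1≤x = ≤-trans (m≤m*n x x) (m≤m*n (x * x) x)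
  where instance
    x≢0 : NonZero x
    x≢0 = >-nonZero 1≤x

-- The third power suffices for addresses: each factor of (n + 1)(c + 1)(c + 1) is at most the base
-- of the word bound.
cube≤power : ∀ {x k} → 1 ≤ x → 3 ≤ k → x * x * x ≤ x ^ k
cube≤power {x} 1≤x 3≤k = ≤-trans (≤-reflexive cube≡) (^-monoʳ-≤ x {{>-nonZero 1≤x}} 3≤k)
  where
  cube≡ : x * x * x ≡ x ^ 3
  cube≡ = trans (*-assoc x x x) (cong (λ y → x * (x * y)) (sym (*-identityʳ x)))

module WordBound (In : List ℕ) where

  X W : ℕ
  X = 2 + length In + max 0 In
  W = wordBound K In

  1≤X : 1 ≤ X
  1≤X = s≤s z≤n

  X*X*X≤W : X * X * X ≤ W
  X*X*X≤W = cube≤power 1≤X (≤K 3 tt)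

  X≤W : X ≤ W
  X≤W = ≤-trans (≤-cube 1≤X) X*X*X≤W

  1≤W : 1 ≤ W
  1≤W = ≤-trans 1≤X X≤W

  length≤X : length In ≤ X
  length≤X = ≤-trans (m≤n+m (length In) 2) (m≤m+n (2 + length In) (max 0 In))

  at<X : ∀ {p v} → At In p v → suc v ≤ X
  at<X at = s≤s (≤-trans (at-≤-max In at) (m≤n+m (max 0 In) (suc (length In))))

  at≤W : ∀ {p v} → At In p v → v ≤ W
  at≤W at = ≤-trans (<⇒≤ (at<X at)) X≤W

constant≤ : ∀ {k} K size → k ≤ K → k ≤ K * size + K
constant≤ K size k≤K = ≤-trans k≤K (m≤n+m K (K * size))

scaled≤ : ∀ {j} k l K size → j ≤ k * size → k ≤ K → l ≤ K → j + l ≤ K * size + K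
scaled≤ k l K size j≤ k≤K l≤K = +-mono-≤ (≤-trans j≤ (*-monoˡ-≤ size k≤K)) l≤K


bit≤1 : ∀ {P : Set} (P? : Dec P) → [ P? ]· 1 ≤ 1
bit≤1 (yes _) = ≤-refl
bit≤1 (no _)  = z≤n

-- The price of passing from c + 1 admissible sizes to c; since c + 1 ≤ 2c, squaring costs a factor
-- 4.
C*C≤ : ∀ {c} → 1 ≤ c → suc c * suc c ≤ 4 * c ^ 2
C*C≤ {c} 1≤c = begin
  suc c * suc c         ≤⟨ *-mono-≤ C≤2c C≤2c ⟩
  (2 * c) * (2 * c)     ≡⟨ *-assoc 2 c (2 * c) ⟩
  2 * (c * (2 * c))     ≡⟨ cong (2 *_) (trans (sym (*-assoc c 2 c)) (trans (cong (_* c) (*-comm c 2)) (*-assoc 2 c c))) ⟩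
  2 * (2 * (c * c))     ≡⟨ sym (*-assoc 2 2 (c * c)) ⟩
  4 * (c * c)           ≡⟨ cong (λ x → 4 * (c * x)) (sym (*-identityʳ c)) ⟩
  4 * c ^ 2             ∎
  where
  open ≤-Reasoning
  C≤2c : suc c ≤ 2 * c
  C≤2c = +-mono-≤ 1≤c (m≤m+n c 0)

-- Running the program on an instance

module Encoding (I : OBI-Instance) where
  open OBI-Instance I

  In : List ℕ
  In = encodeOBI I

  open WordBound In public

  at-n : At In 0 n
  at-n = found Fin.zero refl refl

  at-c : At In 1 c
  at-c = found (Fin.suc Fin.zero) refl refl

  row : Fin n → List ℕ
  row u = List.map (λ v → [ Graph.adj? G u v ]· 1) (allFin n)

  at-σ : ∀ i → At In (2 + toℕ i) (toℕ (σ ⟨$⟩ʳ i))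
  at-σ i = at-∷ (at-∷ (at-++ˡ (at-map-allFin (toℕ ∘ (σ ⟨$⟩ʳ_)) i)))

  at-adj : ∀ u v → At In (2 + (n + toℕ u * n + toℕ v)) ([ Graph.adj? G u v ]· 1)
  at-adj u v = at-∷ (at-∷ (subst
    (λ p → At (List.map (toℕ ∘ (σ ⟨$⟩ʳ_)) (allFin n) ++ concatMap row (allFin n)) p ([ Graph.adj? G u v ]· 1))
    (trans (cong (_+ (toℕ u * n + toℕ v)) (length-map-allFin n (toℕ ∘ (σ ⟨$⟩ʳ_)))) (sym (+-assoc n _ _)))
    (at-++ʳ (List.map (toℕ ∘ (σ ⟨$⟩ʳ_)) (allFin n))
      (at-concatMap row (λ u → length-map-allFin n _) id u (at-map-allFin (λ v → [ Graph.adj? G u v ]· 1) v)))))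

  length-In : length In ≡ 2 + (n + n * n)
  length-In = cong (2 +_) (trans (length-++ (List.map (toℕ ∘ (σ ⟨$⟩ʳ_)) (allFin n)))
    (cong₂ _+_ (length-map-allFin n (toℕ ∘ (σ ⟨$⟩ʳ_))) (length-concatMap row (λ u → length-map-allFin n _) id)))

  length≤W : 2 + (n + n * n) ≤ W
  length≤W = ≤-trans (≤-reflexive (sym length-In)) (≤-trans length≤X X≤W)

  space≤W : suc n * suc c * suc c ≤ W
  space≤W = ≤-trans (*-mono-≤ (*-mono-≤ (at<X at-n) (at<X at-c)) (at<X at-c)) X*X*X≤W

module Execute (I : OBI-Instance) where
  open OBI-Instance I
  open Encoding I

  size : ℕ
  size = n * c ^ 2

  Solution : Set
  Solution = Σ[ S ∈ ℕ ] Σ[ s ∈ State 14 3 ] Σ[ t ∈ ℕ ]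
    (Execution._⊢_⇓_within_ W S In initial main s t
    × AnswersOBI I (output s)
    × t ≤ K * size + K
    × 14 + 3 * S ≤ K * size + K)

  Answered : State 14 3 → Set
  Answered s = AnswersOBI I (output s)

  module _ (S : ℕ) where
    open Logic W S In

    afterReading : State 14 3
    afterReading =
      ⟨ n ∷ c ∷ 0 ∷ 0 ∷ 0 ∷ 0 ∷ 0 ∷ 0 ∷ 0 ∷ 0 ∷ 0 ∷ 0 ∷ 0 ∷ 0 ∷ [] ,
        (λ _ → 0) ∷ (λ _ → 0) ∷ (λ _ → 0) ∷ [] ⟩

    run-main : ∀ {T} → Run dispatch afterReading T Answered → Run main initial (2 + T) Answered
    run-main run = run-seq {p = readParameters} (run-wp readParameters
      (n , at-n , at≤W at-n , c , at-c , at≤W at-c , run))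

    conclude : ∀ {T} → Run main initial T Answered →
               T ≤ K * size + K → 14 + 3 * S ≤ K * size + K → Solution
    conclude (ran e t≤ answered) time space = S , _ , _ , e , answered , ≤-trans t≤ time , space

    solution : ∀ {T} → Run dispatch afterReading T Answered →
               2 + T ≤ K * size + K → 14 + 3 * S ≤ K * size + K → Solution
    solution run = conclude (run-main run)

  solution-empty : n < 1 → AnswersOBI I ((λ _ → 0) [ 0 ↦ 1 ]) → Solution
  solution-empty n<1 answer = solution 2
    (run-wp dispatch
      ((λ _ → 0 , 1 , refl , refl , s≤s z≤n , 1≤W , answer) ,
       λ 1≤n → contradiction n<1 (≤⇒≯ 1≤n)))
    (constant≤ K size (≤K (2 + cost dispatch) tt))
    -- 20 = 14 + 3 * 2: the registers and three arrays of two cells, paid for by the additive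
    -- constant since the size is 0 here.
    (constant≤ K size (≤K 20 tt))
    where open Logic W 2 In

  solution-infeasible : 1 ≤ n → c < 1 → AnswersOBI I (λ _ → 0) → Solution
  solution-infeasible 1≤n c<1 answer = solution 2
    (run-wp dispatch
      ((λ n<1 → contradiction n<1 (≤⇒≯ 1≤n)) , λ _ →
       (λ _ → answer) , λ 1≤c → contradiction c<1 (≤⇒≯ 1≤c)))
    (constant≤ K size (≤K (2 + cost dispatch) tt))
    (constant≤ K size (≤K 20 tt))
    where open Logic W 2 In

  module _ (1≤n : 1 ≤ n) (1≤c : 1 ≤ c) where

    tableSize : ℕ
    tableSize = suc n * suc c * suc c

    C*C≤4size : n * (suc c * suc c) ≤ 4 * size
    C*C≤4size = ≤-trans (*-monoʳ-≤ n (C*C≤ 1≤c)) (≤-reflexive (swap n 4 (c ^ 2)))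
      where
      swap : ∀ x y z → x * (y * z) ≡ y * (x * z)
      swap x y z = trans (sym (*-assoc x y z)) (trans (cong (_* z) (*-comm x y)) (*-assoc y x z))

    -- 8 = 2 * 4, from n + 1 ≤ 2n and (c + 1)^2 ≤ 4c^2.
    tableSize≤ : tableSize ≤ 8 * size
    tableSize≤ = rescale 2 4 size
      (begin
        suc n * suc c * suc c      ≡⟨ *-assoc (suc n) (suc c) (suc c) ⟩
        suc n * (suc c * suc c)    ≤⟨ *-monoˡ-≤ (suc c * suc c) (+-mono-≤ 1≤n (m≤m+n n 0)) ⟩
        2 * n * (suc c * suc c)    ≡⟨ *-assoc 2 n (suc c * suc c) ⟩
        2 * (n * (suc c * suc c))  ∎)
      C*C≤4size
      where open ≤-Reasoning

    -- The 4 counts the two reads of parameters and the two tests of `dispatch`.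
    time≤ : 4 + timeSolve n c ≤ K * size + K
    time≤ = subst (_≤ K * size + K) (+-comm (timeSolve n c) 4)
      (scaled≤ (solveK * 4) 4 K size
        (rescale solveK 4 size (timeSolve-bound c n 1≤n) C*C≤4size)
        (≤K (solveK * 4) tt) (≤K 4 tt))

    space≤ : 14 + 3 * tableSize ≤ K * size + K
    space≤ = subst (_≤ K * size + K) (+-comm (3 * tableSize) 14)
      (scaled≤ 24 14 K size
        (rescale 3 8 size ≤-refl tableSize≤)
        (≤K 24 tt) (≤K 14 tt))

    solution-feasible : Logic.Run W tableSize In solve (afterReading tableSize) (timeSolve n c) Answered →
                        Solution
    solution-feasible run = solution tableSize
      (run-else 1≤n (run-else 1≤c run)) time≤ space≤
      where open Logic W tableSize In

solve-empty : ∀ (G : Graph 0) σ c → Execute.Solution (record { n = zero ; G = G ; σ = σ ; c = c })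
solve-empty G σ c = Execute.solution-empty I (s≤s z≤n)
  (inj₂ (refl , empty , (((λ { {()} }) , z≤n) , λ _ _ → z≤n) , refl , λ ()))
  where
  I = record { n = zero ; G = G ; σ = σ ; c = c }
  empty : Arrangement 0
  empty = record { k = 0 ; bucket = λ () ; nonempty = λ () }

solve-infeasible : ∀ n (G : Graph (suc n)) σ → Execute.Solution (record { n = suc n ; G = G ; σ = σ ; c = zero })
solve-infeasible n G σ = Execute.solution-infeasible I (s≤s z≤n) (s≤s z≤n)
  (inj₁ (refl , λ { (B , ordered , width≤0) →
     contradiction (≤-trans (Layout.width-positive G σ 0 B ordered) width≤0) λ () }))
  where
  I = record { n = suc n ; G = G ; σ = σ ; c = zero }

solve-feasible : ∀ n c (G : Graph (suc n)) σ →
                 Execute.Solution (record { n = suc n ; G = G ; σ = σ ; c = suc c })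
solve-feasible n′ c′ G σ = solution-feasible (s≤s z≤n) (s≤s z≤n) (run-weaken ≤-refl answer run-solve)
  where
  I = record { n = suc n′ ; G = G ; σ = σ ; c = suc c′ }
  open OBI-Instance I using (n; c)
  open Execute I
  open Encoding I
  open Layout G σ using (vertex; position; position-<; vertex-position; position-vertex; adjBit)
  open Layout.Best G σ c z<s
  at-vertex : ∀ {p} → p < n → At In (2 + p) (toℕ (vertex p))
  at-vertex {p} p<n = subst (λ q → At In (2 + q) (toℕ (vertex p)))
    (trans (Fin.toℕ-fromℕ< _) (m<n⇒m%n≡m p<n)) (at-σ (p mod n))
  open Correctness n c z<s z<s adjBit
    (λ q p → bit≤1 (Graph.adj? G (vertex q) (vertex p)))
    (λ p → toℕ (vertex p)) (λ _ → Fin.toℕ<n _)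
    (λ {p} {q} p<n q<n eq → trans (sym (position-vertex p<n))
      (trans (cong position (Fin.toℕ-injective eq)) (position-vertex q<n)))
    W In space≤W length≤W at-vertex (λ {q} {p} _ _ → at-adj (vertex q) (vertex p))
  open Logic W S In
  answer : ∀ {s} → Solved s → AnswersOBI I (output s)
  answer {s} done = inj₂ (solved , arrangement ,
    ((arrangement-ordered , arrangement-width) , λ { B (ordered , width≤c) → arrangement-optimal B ordered width≤c }) ,
    count , λ v → trans (cong (λ u → output s (2 + toℕ u)) (sym (vertex-position v)))
                        (trans (bucket (position-< v)) (sym (Fin.toℕ-fromℕ< (place< v)))))
    where open Solved done

solve-instance : ∀ I → Execute.Solution I
solve-instance record { n = zero  ; G = G ; σ = σ ; c = c }     = solve-empty G σ c
solve-instance record { n = suc n ; G = G ; σ = σ ; c = zero }  = solve-infeasible n G σ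
solve-instance record { n = suc n ; G = G ; σ = σ ; c = suc c } = solve-feasible n c G σ

theorem7 : SolvableInTimeAndSpaceO OrderedBucketIntegrity
    (λ I → OBI-Instance.n I * OBI-Instance.c I ^ 2)
theorem7 = 14 , 2 , main , K , solve-instance
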